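{- Let $G$ be a graph and $\mathcal{P}=\{V_1,\dots,V_t\}$ a partition of $V(G)$ into sets each inducing a clique, such that $G_{\mathcal{P}}$ has maximum degree $\Delta$. Let $U_i\subseteq V_i$ be constructed as described in the context, let $H=G[\bigcup_i U_i]$ and $\mathcal{P}'=\{U_i: V_i\in\mathcal{P}\}$. Then $G$ has a canonical cycle cover (with respect to $\mathcal{P}$) of size $k$ if and only if $H$ has a canonical cycle cover (with respect to $\mathcal{P}'$) of size $k$.
   Context: $G_{\mathcal{P}}$ is obtained from $G$ by contracting each $V_i$ to a vertex (removing loops and parallel edges); $N(V_i)$ denotes the neighbours of $V_i$ in $G_{\mathcal{P}}$. $E(U,W)$ is the set of edges between disjoint sets $U,W$. A cycle cover of a graph is a set of vertex-disjoint cycles whose vertex sets cover all vertices; its size is the number of cycles. For a partition $\mathcal{Q}$ of the vertex set into cliques, a set $\mathcal{C}$ of vertex-disjoint cycles is canonical if (1) for every part $W$ at most one $C\in\mathcal{C}$ has $V(C)\subseteq W$, and (2) for every two distinct parts $W,W'$ at most one $C\in\mathcal{C}$ has $E(C)\cap E(W,W')\neq\emptyset$, and for it $|E(C)\cap E(W,W')|\le 2$. Construction of $U_i$: for $V_i\in\mathcal{P}$ and $V_j\in N(V_i)$, let $V_i(j)=\{v\in V_i:N(v)\cap V_j\ne\emptyset\}$; let $H_{ij}$ be the bipartite graph on $V_i(j)\cup V_j(i)$ with edge set $E(V_i,V_j)$, $M_{ij}$ a maximal matching of $H_{ij}$, $M'_{ij}\subseteq M_{ij}$ an arbitrary subset of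 size $\min\{6\Delta,|M_{ij}|\}$, and $L_i(j)$ (resp. $L_j(i)$) the endpoints of $M'_{ij}$ in $V_i$ (resp. $V_j$). If $|M_{ij}|\ge 6\Delta$, set $U_i(j)=L_i(j)$, $U_j(i)=L_j(i)$. Otherwise set $U_i(j)=L_i(j)$, $U_j(i)=L_j(i)$, then for each $u\in L_i(j)$ add $\min\{|N(u)\cap V_j|,6\Delta-1\}$ neighbours of $u$ in $V_j$ to $U_j(i)$, and for each $v\in L_j(i)$ add $\min\{|N(v)\cap V_i|,6\Delta-1\}$ neighbours of $v$ in $V_i$ to $U_i(j)$. Let $U_i=\bigcup_{V_j\in N(V_i)}U_i(j)$, and finally add $\min\{4\Delta+3,|V_i\setminus U_i|\}$ arbitrary vertices of $V_i\setminus U_i$ to $U_i$. -}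

module Defs where

open import Data.Nat using (ℕ; zero; suc; _+_; _*_; _∸_; _≤_; _<_; _⊓_)
open import Data.Bool using (Bool; true; false; _∧_; _∨_; not; if_then_else_)
open import Data.Fin using (Fin; _≟_)
import Data.Fin as Fin
open import Data.List using (List; []; _∷_; _++_; zip; length; concat; lookup)
open import Data.List.Relation.Unary.All using (All)
open import Data.List.Relation.Unary.Unique.Propositional using (Unique)
open import Data.List.Membership.Propositional using (_∈_)
open import Data.Product using (Σ; _×_; _,_; ∃)
import Data.Product
open import Data.Sum using (_⊎_)
open import Relation.Binary.PropositionalEquality using (_≡_; _≢_)
open import Relation.Nullary.Decidable using (⌊_⌋)

count : ∀ {n} → (Fin n → Bool) → ℕ
count {zero}  f = 0
count {suc n} f = (if f Fin.zero then 1 else 0) + count (λ i → f (Fin.suc i))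

anyF : ∀ {n} → (Fin n → Bool) → Bool
anyF {zero}  f = false
anyF {suc n} f = f Fin.zero ∨ anyF (λ i → f (Fin.suc i))

_==F_ : ∀ {t} → Fin t → Fin t → Bool
i ==F j = ⌊ i ≟ j ⌋

countL : ∀ {A : Set} → (A → Bool) → List A → ℕ
countL p []       = 0
countL p (x ∷ xs) = (if p x then 1 else 0) + countL p xs

record Graph (n : ℕ) : Set where
  field
    adj    : Fin n → Fin n → Bool
    sym    : ∀ u v → adj u v ≡ adj v u
    irrefl : ∀ v → adj v v ≡ false
open Graph public

IsCliquePartition : ∀ {n t} → Graph n → (Fin n → Fin t) → Set
IsCliquePartition G part =
  (∀ i → ∃ λ v → part v ≡ i) ×
  (∀ u v → part u ≡ part v → u ≢ v → adj G u v ≡ true)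

quotAdj : ∀ {n t} → Graph n → (Fin n → Fin t) → Fin t → Fin t → Bool
quotAdj G part i j =
  not (i ==F j) ∧ anyF (λ u → anyF (λ v → (part u ==F i) ∧ (part v ==F j) ∧ adj G u v))

quotDeg : ∀ {n t} → Graph n → (Fin n → Fin t) → Fin t → ℕ
quotDeg G part i = count (quotAdj G part i)

MaxDegreeQuot : ∀ {n t} → Graph n → (Fin n → Fin t) → ℕ → Set
MaxDegreeQuot G part Δ = (∀ i → quotDeg G part i ≤ Δ) × (∃ λ i → quotDeg G part i ≡ Δ)

-- The construction of the sets U_i.
-- All choices made by the construction (the maximal matchings M_ij, the
-- subsets M'_ij, the added neighbours, the final arbitrary vertices) are
-- recorded as data; the theorem quantifies over every admissible choice.
-- M (resp. M') is the union over all pairs {i,j} of M_ij (resp. M'_ij),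
-- as a symmetric edge set.

-- number of vertices of V_i matched by E into V_j  (= |E_ij| for a matching)
matched : ∀ {n t} → (Fin n → Fin t) → (Fin n → Fin n → Bool) → Fin t → Fin t → ℕ
matched part E i j = count (λ u → (part u ==F i) ∧ anyF (λ v → E u v ∧ (part v ==F j)))

record Construction {n t} (G : Graph n) (part : Fin n → Fin t) (Δ : ℕ) : Set where
  field
    M        : Fin n → Fin n → Bool
    M-edge   : ∀ u v → M u v ≡ true → adj G u v ≡ true × part u ≢ part v
    M-sym    : ∀ u v → M u v ≡ M v u
    M-match  : ∀ u v v' → M u v ≡ true → M u v' ≡ true → part v ≡ part v' → v ≡ v'
    M-max    : ∀ u v → adj G u v ≡ true → part u ≢ part v →
               (∃ λ v' → M u v' ≡ true × part v' ≡ part v) ⊎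
               (∃ λ u' → M v u' ≡ true × part u' ≡ part u)
    M'       : Fin n → Fin n → Bool
    M'-sub   : ∀ u v → M' u v ≡ true → M u v ≡ true
    M'-sym   : ∀ u v → M' u v ≡ M' v u
    M'-size  : ∀ i j → i ≢ j → matched part M' i j ≡ (6 * Δ) ⊓ matched part M i j
    -- Add v w : w was added (as neighbour of v ∈ L_{part v}(part w)) in the
    -- case |M_ij| < 6Δ
    Add      : Fin n → Fin n → Bool
    Add-ok   : ∀ v w → Add v w ≡ true →
               adj G v w ≡ true ×
               (∃ λ u → M' v u ≡ true × part u ≡ part w) ×
               matched part M (part v) (part w) < 6 * Δ
    Add-size : ∀ v j → (∃ λ u → M' v u ≡ true × part u ≡ j) →
               matched part M (part v) j < 6 * Δ →
               count (λ w → Add v w ∧ (part w ==F j)) ≡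
                 count (λ w → adj G v w ∧ (part w ==F j)) ⊓ (6 * Δ ∸ 1)
    Extra    : Fin n → Bool
  -- u ∈ ⋃_j U_{part u}(j): u ∈ L_{part u}(j) for some j, or u was added
  base : Fin n → Bool
  base u = anyF (λ v → M' u v ∨ Add v u)
  field
    Extra-new  : ∀ u → Extra u ≡ true → base u ≡ false
    Extra-size : ∀ i → count (λ u → Extra u ∧ (part u ==F i)) ≡
                   (4 * Δ + 3) ⊓ count (λ u → (part u ==F i) ∧ not (base u))
  U : Fin n → Bool
  U u = base u ∨ Extra u

-- Cycles and canonical cycle covers.
-- A cycle is a list of ≥ 3 distinct vertices, cyclically consecutive ones
-- adjacent. Covers of the induced subgraph G[S] are cycle covers with all
-- vertices in S covering S.

cycEdges : ∀ {A : Set} → List A → List (A × A)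
cycEdges []       = []
cycEdges (x ∷ xs) = zip (x ∷ xs) (xs ++ x ∷ [])

IsCycle : ∀ {n} → Graph n → (Fin n → Bool) → List (Fin n) → Set
IsCycle G S c =
  3 ≤ length c × Unique c × All (λ v → S v ≡ true) c ×
  All (λ e → adj G (Data.Product.proj₁ e) (Data.Product.proj₂ e) ≡ true) (cycEdges c)

IsCycleCover : ∀ {n} → Graph n → (Fin n → Bool) → List (List (Fin n)) → Set
IsCycleCover G S cs =
  All (IsCycle G S) cs × Unique (concat cs) × (∀ v → S v ≡ true → v ∈ concat cs)

AtMostOne : ∀ {A : Set} → (A → Set) → List A → Set
AtMostOne P xs = ∀ (a b : Fin (length xs)) → P (lookup xs a) → P (lookup xs b) → a ≡ b

crossCount : ∀ {n t} → (Fin n → Fin t) → Fin t → Fin t → List (Fin n) → ℕ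
crossCount part i j c =
  countL (λ e → ((part (Data.Product.proj₁ e) ==F i) ∧ (part (Data.Product.proj₂ e) ==F j)) ∨
                ((part (Data.Product.proj₁ e) ==F j) ∧ (part (Data.Product.proj₂ e) ==F i)))
         (cycEdges c)

IsCanonical : ∀ {n t} → (Fin n → Fin t) → List (List (Fin n)) → Set
IsCanonical part cs =
  (∀ i → AtMostOne (λ c → All (λ v → part v ≡ i) c) cs) ×
  (∀ i j → i ≢ j →
     AtMostOne (λ c → 1 ≤ crossCount part i j c) cs ×
     All (λ c → crossCount part i j c ≤ 2) cs)

-- G[S] has a canonical cycle cover of size k w.r.t. the partition
-- {V_i ∩ S}
HasCanonicalCover : ∀ {n t} → Graph n → (Fin n → Fin t) → (Fin n → Bool) → ℕ → Set
HasCanonicalCover {n} G part S k =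
  Σ (List (List (Fin n))) λ cs → IsCycleCover G S cs × IsCanonical part cs × length cs ≡ k

allV : ∀ {n} → Fin n → Bool
allV _ = true

{-# OPTIONS --safe #-}

-- A canonical cover is stored as its cycles that cross between parts together with the list of parts
-- containing a whole cycle; the latter cycles only matter through having three vertices left over in
-- their part. Deleting from the crossing cycles every vertex that meets no cross edge leaves at most
-- 2Δ vertices in each part. A cross edge u v not inside U is then rerouted, inside the two cliques,
-- through unused endpoints in U: of another edge of M'_ij if M_ij is large, and of an added edge at
-- the matched endpoint otherwise. Once every cross edge lies in U the tightened cycles do too, and
-- the remaining vertices of either vertex set are inserted at an edge inside their part or collected
-- into the cycle of their part. A part larger than U_i has 4Δ + 3 > 2Δ extra vertices in U_i, so
-- some vertex of U_i is left over, which forces such an edge or leaves room for such a cycle.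
module Submission where

open import Defs renaming (sym to adj-sym)
open import Data.Nat using (ℕ; zero; suc; _+_; _*_; _∸_; _≤_; _<_; _⊓_; z≤n; s≤s; _≤?_)
open import Data.Nat.Properties hiding (_≟_)
open import Data.Bool using (Bool; true; false; _∧_; _∨_; not; if_then_else_) renaming (_≟_ to _≟ᵇ_)
open import Data.Bool.Properties using (∧-zeroʳ; ∧-conicalˡ; ∧-conicalʳ; ∨-zeroʳ)
open import Data.Fin using (Fin; _≟_)
import Data.Fin as Fin
import Data.Fin.Properties as Fin
open import Data.List using (List; []; _∷_; _∷ʳ_; _++_; zip; length; concat; map; filter; allFin; tabulate; initLast; _∷ʳ′_)
open import Data.List.Properties
  using (filter-++; filter-none; ++-identityʳ; ++-assoc; length-++; length-++-sucʳ; length-map; concat-++; ∷ʳ-injective)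
open import Data.List.Relation.Unary.All as All using (All; []; _∷_)
import Data.List.Relation.Unary.All.Properties as Allₚ
open import Data.List.Relation.Unary.Any using (Any; here; there; any?; index)
open import Data.List.Relation.Unary.Any.Properties using (lookup-index)
open import Data.List.Relation.Unary.AllPairs as AllPairs using (AllPairs; []; _∷_)
import Data.List.Relation.Unary.AllPairs.Properties as AllPairsₚ
open import Data.List.Relation.Unary.Unique.Propositional using (Unique)
import Data.List.Relation.Unary.Unique.Propositional.Properties as Uniqueₚ
open import Data.List.Membership.Propositional using (_∈_; _∉_; find; lose)
open import Data.List.Membership.Propositional.Properties
open import Data.List.Relation.Binary.Permutation.Propositional
  using (_↭_; ↭-refl; ↭-sym; ↭-trans; ↭-reflexive; prep; swap; ↭⇒↭ₛ; module PermutationReasoning)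
  renaming (refl to ↭refl; trans to ↭trans)
open import Data.List.Relation.Binary.Permutation.Propositional.Properties
  using (All-resp-↭; ∈-resp-↭; ↭-length; shift; shifts; ++⁺ˡ; ++⁺ʳ; ++-comm) renaming (map⁺ to ↭-map⁺)
import Data.List.Relation.Binary.Permutation.Setoid.Properties as Setoid↭
open import Data.Product using (_×_; _,_; ∃; ∃₂; proj₁; proj₂)
open import Data.Sum using (_⊎_; inj₁; inj₂; [_,_]′)
open import Data.Empty using (⊥)
open import Function.Base using (_∘_; id; case_of_)
open import Function.Bundles using (_⇔_; mk⇔)
open import Relation.Binary.PropositionalEquality
  using (_≡_; _≢_; refl; sym; trans; cong; cong₂; subst; ≢-sym; setoid; resp₂)
open import Relation.Binary.Definitions using (Symmetric)
open import Relation.Nullary using (¬_; Dec; yes; no; contradiction; ¬?)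
open import Relation.Nullary.Decidable using (_×-dec_; _⊎-dec_; decidable-stable)
import Data.List.Membership.DecPropositional as DecMembership

-- Counting

-- Canonicity sees a crossing cycle only through the numbers of its edges between pairs of parts.
-- Every change made below keeps these numbers: a vertex is deleted between two vertices of its own
-- part, or an edge is replaced by a path with the same cross counts. So neither the number of
-- cycles nor the canonical bounds have to be re-examined. After a rerouting the old ends of the
-- edge may no longer meet any cross edge, so the bound 2Δ is lost. The cycles are therefore
-- tightened again before each rerouting. The recursion is on the number of cross edges not inside
-- U, which tightening leaves fixed. The constants work because a cross edge gives Δ ≥ 1. At most 4Δ
-- vertices are in use in two parts, against 6Δ edges of a large M'_ij; at most 2Δ are in use in one
-- part, against 6Δ - 1 added neighbours. A rerouting spends at most one vertex per part, and only
-- in parts with at least 6Δ ≥ (2Δ + 1) + 3 vertices, so three remain for a cycle of that part.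

true≢false : ∀ {b} → b ≡ true → b ≡ false → ⊥
true≢false refl ()

==F⇒≡ : ∀ {t} {i j : Fin t} → (i ==F j) ≡ true → i ≡ j
==F⇒≡ {i = i} {j} eq with i ≟ j
... | yes p = p
==F⇒≡ () | no _

≡⇒==F : ∀ {t} {i j : Fin t} → i ≡ j → (i ==F j) ≡ true
≡⇒==F {i = i} {j} eq with i ≟ j
... | yes _ = refl
... | no i≢j = contradiction eq i≢j

≢⇒==F : ∀ {t} {i j : Fin t} → i ≢ j → (i ==F j) ≡ false
≢⇒==F {i = i} {j} i≢j with i ≟ j
... | yes eq = contradiction eq i≢j
... | no _ = refl

∧-true : ∀ {a b} → a ≡ true → b ≡ true → a ∧ b ≡ true
∧-true refl refl = refl

∨-true⁻ : ∀ {a b} → a ∨ b ≡ true → a ≡ true ⊎ b ≡ true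
∨-true⁻ {true} _ = inj₁ refl
∨-true⁻ {false} eq = inj₂ eq

∨-true⁺ʳ : ∀ a {b} → b ≡ true → a ∨ b ≡ true
∨-true⁺ʳ a refl = ∨-zeroʳ a

anyF⁺ : ∀ {n} {f : Fin n → Bool} i → f i ≡ true → anyF f ≡ true
anyF⁺ {f = f} Fin.zero eq rewrite eq = refl
anyF⁺ {f = f} (Fin.suc i) eq = ∨-true⁺ʳ (f Fin.zero) (anyF⁺ i eq)

anyF⁻ : ∀ {n} {f : Fin n → Bool} → anyF f ≡ true → ∃ λ i → f i ≡ true
anyF⁻ {suc n} eq with ∨-true⁻ eq
... | inj₁ p = Fin.zero , p
... | inj₂ q with anyF⁻ q
...   | i , p = Fin.suc i , p

-- Removing from `ys` the element chosen for the head spoils no later choice, by `inj`. A relation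
-- replaces a function because the images (matching partners, cross edges) come from existence
-- statements.
pigeonhole : ∀ {A B : Set} {R : A → B → Set} {xs : List A} {ys : List B} → Unique xs →
  (∀ {x} → x ∈ xs → ∃ λ y → y ∈ ys × R x y) →
  (∀ {x x' y} → R x y → R x' y → x ≡ x') →
  length xs ≤ length ys
pigeonhole {xs = []} u f inj = z≤n
pigeonhole {R = R} {x ∷ xs} {ys} (x∉ ∷ u) f inj with f (here refl)
... | y , y∈ , r with ∈-∃++ y∈
...   | as , bs , refl = subst (suc (length xs) ≤_) (sym (length-++-sucʳ as y bs))
                           (s≤s (pigeonhole u f' inj))
  where
  f' : ∀ {x'} → x' ∈ xs → ∃ λ y' → y' ∈ as ++ bs × R x' y'
  f' x'∈ with f (there x'∈)
  ... | y' , y'∈ , r' with ∈-++⁻ as y'∈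
  ...   | inj₁ q = y' , ∈-++⁺ˡ q , r'
  ...   | inj₂ (there q) = y' , ∈-++⁺ʳ as q , r'
  ...   | inj₂ (here refl) = contradiction (inj r r') (All.lookup x∉ x'∈)

module _ {n : ℕ} where

  open DecMembership (_≟_ {n}) public using (_∈?_)

  elems : (Fin n → Bool) → List (Fin n)
  elems f = filter (λ v → f v ≟ᵇ true) (allFin n)

  ∈-elems⁺ : ∀ {f v} → f v ≡ true → v ∈ elems f
  ∈-elems⁺ {f} eq = ∈-filter⁺ (λ v → f v ≟ᵇ true) (∈-allFin _) eq

  ∈-elems⁻ : ∀ {f v} → v ∈ elems f → f v ≡ true
  ∈-elems⁻ {f} v∈ = proj₂ (∈-filter⁻ (λ v → f v ≟ᵇ true) {xs = allFin n} v∈)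

  elems-unique : ∀ f → Unique (elems f)
  elems-unique f = Uniqueₚ.filter⁺ (λ v → f v ≟ᵇ true) (Uniqueₚ.allFin⁺ n)

count-tabulate : ∀ {m n} (f : Fin n → Bool) (g : Fin m → Fin n) →
  count (f ∘ g) ≡ length (filter (λ v → f v ≟ᵇ true) (tabulate g))
count-tabulate {zero} f g = refl
count-tabulate {suc m} f g with f (g Fin.zero)
... | true = cong suc (count-tabulate f (g ∘ Fin.suc))
... | false = count-tabulate f (g ∘ Fin.suc)

count-elems : ∀ {n} (f : Fin n → Bool) → count f ≡ length (elems f)
count-elems f = count-tabulate f id

module _ {n : ℕ} {f : Fin n → Bool} where

  count-pigeonhole : {B : Set} {R : Fin n → B → Set} {ys : List B} →
    (∀ {u} → f u ≡ true → ∃ λ y → y ∈ ys × R u y) →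
    (∀ {u u' y} → R u y → R u' y → u ≡ u') →
    count f ≤ length ys
  count-pigeonhole {R = R} h inj rewrite count-elems f =
    pigeonhole {R = R} (elems-unique f) (h ∘ ∈-elems⁻) inj

  count-≤-length : ∀ {ys} → (∀ {u} → f u ≡ true → u ∈ ys) → count f ≤ length ys
  count-≤-length h = count-pigeonhole {R = _≡_} (λ p → _ , h p , refl) (λ { refl refl → refl })

  length-≤-count : ∀ {xs} → Unique xs → (∀ {x} → x ∈ xs → f x ≡ true) → length xs ≤ count f
  length-≤-count uniq h rewrite count-elems f =
    pigeonhole {R = _≡_} uniq (λ x∈ → _ , ∈-elems⁺ (h x∈) , refl) (λ { refl refl → refl })

  count-fresh : ∀ ys → length ys < count f → ∃ λ v → f v ≡ true × v ∉ ys
  count-fresh ys lt with Fin.any? (λ v → (f v ≟ᵇ true) ×-dec ¬? (v ∈? ys))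
  ... | yes p = p
  ... | no ¬p = contradiction (count-≤-length sub) (<⇒≱ lt)
    where
    sub : ∀ {u} → f u ≡ true → u ∈ ys
    sub {u} p with u ∈? ys
    ... | yes q = q
    ... | no q = contradiction (u , p , q) ¬p

  -- This is how a size `k ⊓ count g` gets used: if the minimum is `count g`, the construction left
  -- no candidate out.
  count-saturated : ∀ {g : Fin n → Bool} → (∀ v → f v ≡ true → g v ≡ true) → count g ≤ count f →
    ∀ v → g v ≡ true → f v ≡ true
  count-saturated {g} sub le v gv with f v in eq
  ... | true = refl
  ... | false = contradiction le (<⇒≱ lt)
    where
    lt : count f < count g
    lt rewrite count-elems f | count-elems g =
      pigeonhole {R = _≡_} {xs = v ∷ elems f}
        (Allₚ.¬Any⇒All¬ _ (λ v∈ → true≢false (∈-elems⁻ v∈) eq) ∷ elems-unique f)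
        (λ { (here refl) → v , ∈-elems⁺ gv , refl
           ; (there x∈) → _ , ∈-elems⁺ (sub _ (∈-elems⁻ x∈)) , refl })
        (λ { refl refl → refl })

count-mono : ∀ {n} {f g : Fin n → Bool} → (∀ {v} → f v ≡ true → g v ≡ true) → count f ≤ count g
count-mono {f = f} {g} h = subst (count f ≤_) (sym (count-elems g)) (count-≤-length {f = f} (λ fv → ∈-elems⁺ {f = g} (h fv)))

module _ {A : Set} (p : A → Bool) where

  countL-++ : ∀ xs {ys} → countL p (xs ++ ys) ≡ countL p xs + countL p ys
  countL-++ [] = refl
  countL-++ (x ∷ xs) {ys} = trans (cong ((if p x then 1 else 0) +_) (countL-++ xs))
    (sym (+-assoc (if p x then 1 else 0) _ _))

  countL-↭ : ∀ {xs ys} → xs ↭ ys → countL p xs ≡ countL p ys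
  countL-↭ ↭refl = refl
  countL-↭ (prep x σ) = cong ((if p x then 1 else 0) +_) (countL-↭ σ)
  countL-↭ {x ∷ y ∷ xs} {_ ∷ _ ∷ ys} (swap x y σ) rewrite countL-↭ σ =
    trans (sym (+-assoc a b c)) (trans (cong (_+ c) (+-comm a b)) (+-assoc b a c))
    where
    a = if p x then 1 else 0
    b = if p y then 1 else 0
    c = countL p ys
  countL-↭ (↭trans σ τ) = trans (countL-↭ σ) (countL-↭ τ)

  countL-pos⁺ : ∀ {x xs} → x ∈ xs → p x ≡ true → 1 ≤ countL p xs
  countL-pos⁺ (here refl) eq rewrite eq = s≤s z≤n
  countL-pos⁺ {xs = y ∷ _} (there x∈) eq = ≤-trans (countL-pos⁺ x∈ eq) (m≤n+m _ (if p y then 1 else 0))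

  countL-pos⁻ : ∀ xs → 1 ≤ countL p xs → ∃ λ x → x ∈ xs × p x ≡ true
  countL-pos⁻ (x ∷ xs) le with p x in eq
  ... | true = x , here refl , eq
  ... | false with countL-pos⁻ xs le
  ...   | y , y∈ , py = y , there y∈ , py

  countL-zero : ∀ {xs} → All (λ x → p x ≡ false) xs → countL p xs ≡ 0
  countL-zero [] = refl
  countL-zero (px ∷ h) rewrite px = countL-zero h

countL-filter-≤ : ∀ {A : Set} {Q : A → Set} (q? : ∀ x → Dec (Q x)) {f g : A → Bool} xs →
  (∀ x → Q x → f x ≡ true → g x ≡ true) → countL f (filter q? xs) ≤ countL g xs
countL-filter-≤ q? [] h = z≤n
countL-filter-≤ q? {f} {g} (x ∷ xs) h with q? x
... | no _ = ≤-trans (countL-filter-≤ q? xs h) (m≤n+m _ (if g x then 1 else 0))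
... | yes q with f x in eq
...   | true rewrite h x q eq = s≤s (countL-filter-≤ q? xs h)
...   | false = ≤-trans (countL-filter-≤ q? xs h) (m≤n+m _ (if g x then 1 else 0))

-- Discarding the at most two elements labelled `j` leaves elements labelled in `js`. The labels
-- will be neighbouring parts, and the bound 2 is the one in the definition of canonical.
length-≤-labels : ∀ {A : Set} {t} (lab : A → Fin t) (js : List (Fin t)) (es : List A) →
  (∀ {e} → e ∈ es → lab e ∈ js) → (∀ {j} → j ∈ js → countL (λ e → lab e ==F j) es ≤ 2) →
  length es ≤ 2 * length js
length-≤-labels lab [] [] h le = z≤n
length-≤-labels lab [] (e ∷ es) h le with h (here refl)
... | ()
length-≤-labels {A} lab (j ∷ js) es h le = begin
  length es                                      ≡⟨ split es ⟩
  countL (λ e → lab e ==F j) es + length (rest es) ≤⟨ +-mono-≤ (le (here refl)) ih ⟩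
  2 + 2 * length js                              ≡⟨ *-suc 2 (length js) ⟨
  2 * suc (length js)                            ∎
  where
  open ≤-Reasoning
  other? : ∀ e → Dec (lab e ≢ j)
  other? e = ¬? (lab e ≟ j)
  rest : List A → List A
  rest = filter other?
  split : ∀ es → length es ≡ countL (λ e → lab e ==F j) es + length (rest es)
  split [] = refl
  split (e ∷ es) with lab e ≟ j
  ... | yes _ = cong suc (split es)
  ... | no _ = trans (cong suc (split es)) (sym (+-suc _ _))
  drop : ∀ k es → countL (λ e → lab e ==F k) (rest es) ≤ countL (λ e → lab e ==F k) es
  drop k [] = z≤n
  drop k (e ∷ es) with lab e ≟ j
  ... | yes _ = ≤-trans (drop k es) (m≤n+m _ (if lab e ==F k then 1 else 0))
  ... | no _ = +-monoʳ-≤ (if lab e ==F k then 1 else 0) (drop k es)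
  ih : length (rest es) ≤ 2 * length js
  ih = length-≤-labels lab js (rest es) h' (λ {k} k∈ → ≤-trans (drop k es) (le (there k∈)))
    where
    h' : ∀ {e} → e ∈ rest es → lab e ∈ js
    h' e∈ with ∈-filter⁻ other? {xs = es} e∈
    ... | e∈es , ne with h e∈es
    ...   | here eq = contradiction eq ne
    ...   | there q = q

-- Permutations of lists and cyclic rotations

AllPairs-resp-↭ : ∀ {A : Set} {R : A → A → Set} → Symmetric R →
  ∀ {xs ys} → xs ↭ ys → AllPairs R xs → AllPairs R ys
AllPairs-resp-↭ {A} {R} s σ = Setoid↭.AllPairs-resp-↭ (setoid A) s (resp₂ R) (↭⇒↭ₛ σ)

Unique-resp-↭ : ∀ {A : Set} {xs ys : List A} → xs ↭ ys → Unique xs → Unique ys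
Unique-resp-↭ = AllPairs-resp-↭ ≢-sym

concat-↭ : ∀ {A : Set} {xs ys : List (List A)} → xs ↭ ys → concat xs ↭ concat ys
concat-↭ ↭refl = ↭-refl
concat-↭ (prep x σ) = ++⁺ˡ x (concat-↭ σ)
concat-↭ (swap x y σ) = ↭-trans (shifts x y) (++⁺ˡ y (++⁺ˡ x (concat-↭ σ)))
concat-↭ (↭trans σ τ) = ↭-trans (concat-↭ σ) (concat-↭ τ)

∈⇒↭ : ∀ {A : Set} {x : A} {xs} → x ∈ xs → ∃ λ ys → xs ↭ x ∷ ys
∈⇒↭ x∈ with ∈-∃++ x∈
... | as , bs , refl = as ++ bs , shift _ as bs

-- `AtMostOne` speaks of positions. The pairwise form is a symmetric relation, hence passes through
-- permutations of the list of cycles.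
AtMostOne⇒AllPairs : ∀ {A : Set} {P : A → Set} (xs : List A) →
  AtMostOne P xs → AllPairs (λ a b → ¬ (P a × P b)) xs
AtMostOne⇒AllPairs [] h = []
AtMostOne⇒AllPairs {P = P} (x ∷ xs) h =
  All.tabulate (λ b∈ (px , pb) → head b∈ px pb) ∷
  AtMostOne⇒AllPairs xs (λ a b pa pb → Fin.suc-injective (h (Fin.suc a) (Fin.suc b) pa pb))
  where
  head : ∀ {b} → b ∈ xs → P x → P b → ⊥
  head b∈ px pb with h Fin.zero (Fin.suc (index b∈)) px (subst P (lookup-index b∈) pb)
  ... | ()

AllPairs⇒AtMostOne : ∀ {A : Set} {P : A → Set} {xs : List A} →
  AllPairs (λ a b → ¬ (P a × P b)) xs → AtMostOne P xs
AllPairs⇒AtMostOne (h ∷ hs) Fin.zero Fin.zero pa pb = refl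
AllPairs⇒AtMostOne {xs = _ ∷ xs} (h ∷ hs) Fin.zero (Fin.suc b) pa pb =
  contradiction (pa , pb) (All.lookup h (∈-lookup b))
AllPairs⇒AtMostOne {xs = _ ∷ xs} (h ∷ hs) (Fin.suc a) Fin.zero pa pb =
  contradiction (pb , pa) (All.lookup h (∈-lookup a))
AllPairs⇒AtMostOne (h ∷ hs) (Fin.suc a) (Fin.suc b) pa pb = cong Fin.suc (AllPairs⇒AtMostOne hs a b pa pb)

-- Edges of cyclic lists

-- A cycle `x ∷ xs` is treated as the closed path from `x` through `xs` back to `x`; unlike the
-- `zip` form, a path can be cut at any of its vertices.
pathEdges : ∀ {A : Set} → List A → List (A × A)
pathEdges [] = []
pathEdges (x ∷ []) = []
pathEdges (x ∷ y ∷ zs) = (x , y) ∷ pathEdges (y ∷ zs)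

module _ {A : Set} where

  zip≡pathEdges : ∀ (x : A) xs z → zip (x ∷ xs) (xs ++ z ∷ []) ≡ pathEdges (x ∷ xs ++ z ∷ [])
  zip≡pathEdges x [] z = refl
  zip≡pathEdges x (y ∷ ys) z = cong ((x , y) ∷_) (zip≡pathEdges y ys z)

  pathEdges-++ : ∀ (xs : List A) m ys →
    pathEdges (xs ++ m ∷ ys) ≡ pathEdges (xs ++ m ∷ []) ++ pathEdges (m ∷ ys)
  pathEdges-++ [] m ys = refl
  pathEdges-++ (x ∷ []) m ys = refl
  pathEdges-++ (x ∷ y ∷ xs) m ys = cong ((x , y) ∷_) (pathEdges-++ (y ∷ xs) m ys)

  pathEdges-∈ : ∀ {u v : A} xs → (u , v) ∈ pathEdges xs → ∃₂ λ as bs → xs ≡ as ++ u ∷ v ∷ bs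
  pathEdges-∈ (x ∷ y ∷ zs) (here refl) = [] , zs , refl
  pathEdges-∈ (x ∷ y ∷ zs) (there e∈) with pathEdges-∈ (y ∷ zs) e∈
  ... | as , bs , eq = x ∷ as , bs , cong (x ∷_) eq

  -- Cutting the closed path at the heads of both lists gives the same two paths in either order.
  cycEdges-rotate : ∀ (as bs : List A) → cycEdges (as ++ bs) ↭ cycEdges (bs ++ as)
  cycEdges-rotate [] bs = ↭-reflexive (cong cycEdges (sym (++-identityʳ bs)))
  cycEdges-rotate (a ∷ as) [] = ↭-reflexive (cong cycEdges (++-identityʳ (a ∷ as)))
  cycEdges-rotate (a ∷ as) (b ∷ bs) = begin
    cycEdges (a ∷ as ++ b ∷ bs)
      ≡⟨ expand a as b bs ⟩
    pathEdges (a ∷ as ++ b ∷ []) ++ pathEdges (b ∷ bs ++ a ∷ [])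
      ↭⟨ ++-comm (pathEdges (a ∷ as ++ b ∷ [])) _ ⟩
    pathEdges (b ∷ bs ++ a ∷ []) ++ pathEdges (a ∷ as ++ b ∷ [])
      ≡⟨ expand b bs a as ⟨
    cycEdges (b ∷ bs ++ a ∷ as) ∎
    where
    open PermutationReasoning
    expand : ∀ a as b bs → cycEdges (a ∷ as ++ b ∷ bs) ≡
      pathEdges (a ∷ as ++ b ∷ []) ++ pathEdges (b ∷ bs ++ a ∷ [])
    expand a as b bs = trans (zip≡pathEdges a (as ++ b ∷ bs) a)
      (trans (cong (pathEdges ∘ (a ∷_)) (++-assoc as (b ∷ bs) (a ∷ [])))
             (pathEdges-++ (a ∷ as) b (bs ++ a ∷ [])))

  -- In the closed path the edge is either followed by further vertices, and a rotation brings it to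
  -- the front, or it is the closing edge. The length bound excludes a single vertex, whose closing
  -- edge is a loop.
  rotate-to-edge : ∀ {u v : A} c → 3 ≤ length c → (u , v) ∈ cycEdges c →
    ∃ λ r → c ↭ u ∷ v ∷ r × cycEdges c ↭ cycEdges (u ∷ v ∷ r)
  rotate-to-edge (x ∷ xs) len e∈
    with pathEdges-∈ (x ∷ xs ++ x ∷ []) (subst (_ ∈_) (zip≡pathEdges x xs x) e∈)
  ... | as , bs , eq with initLast bs
  rotate-to-edge {u} {v} (x ∷ xs) len e∈ | as , .(bs ∷ʳ z) , eq | bs ∷ʳ′ z
    with ∷ʳ-injective (x ∷ xs) (as ++ u ∷ v ∷ bs) (trans eq (sym (++-assoc as (u ∷ v ∷ bs) (z ∷ []))))
  ... | refl′ , _ = bs ++ as , ↭-trans (↭-reflexive refl′) (++-comm as (u ∷ v ∷ bs)) ,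
    ↭-trans (↭-reflexive (cong cycEdges refl′)) (cycEdges-rotate as (u ∷ v ∷ bs))
  rotate-to-edge {u} {v} (x ∷ xs) len e∈ | as , .[] , eq | []
    with ∷ʳ-injective (x ∷ xs) (as ++ u ∷ []) (trans eq (sym (++-assoc as (u ∷ []) (v ∷ []))))
  ... | c≡ , refl = closing as c≡ len
    where
    closing : ∀ as {xs} → x ∷ xs ≡ as ++ u ∷ [] → 3 ≤ length (x ∷ xs) →
      ∃ λ r → x ∷ xs ↭ u ∷ x ∷ r × cycEdges (x ∷ xs) ↭ cycEdges (u ∷ x ∷ r)
    closing [] refl (s≤s ())
    closing (x ∷ as) refl _ = as , ++-comm (x ∷ as) (u ∷ []) , cycEdges-rotate (x ∷ as) (u ∷ [])

  zip-in-edge : ∀ {w : A} x xs z → w ∈ xs ++ z ∷ [] → ∃ λ p → (p , w) ∈ zip (x ∷ xs) (xs ++ z ∷ [])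
  zip-in-edge x [] z (here refl) = x , here refl
  zip-in-edge x (y ∷ ys) z (here refl) = x , here refl
  zip-in-edge x (y ∷ ys) z (there w∈) with zip-in-edge y ys z w∈
  ... | p , e∈ = p , there e∈

  in-edge : ∀ {w : A} {c} → w ∈ c → ∃ λ p → (p , w) ∈ cycEdges c
  in-edge {c = x ∷ xs} (here refl) = zip-in-edge x xs x (∈-++⁺ʳ xs (here refl))
  in-edge {c = x ∷ xs} (there w∈) = zip-in-edge x xs x (∈-++⁺ˡ w∈)

  zip-ends : ∀ {P : A → Set} x xs z → All P (x ∷ xs) → P z →
    All (λ e → P (proj₁ e) × P (proj₂ e)) (zip (x ∷ xs) (xs ++ z ∷ []))
  zip-ends x [] z (px ∷ []) pz = (px , pz) ∷ []
  zip-ends x (y ∷ ys) z (px ∷ py ∷ pys) pz = (px , py) ∷ zip-ends y ys z (py ∷ pys) pz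

  cycEdges-ends : ∀ {P : A → Set} {c} → All P c → All (λ e → P (proj₁ e) × P (proj₂ e)) (cycEdges c)
  cycEdges-ends [] = []
  cycEdges-ends {c = x ∷ xs} (px ∷ h) = zip-ends x xs x (px ∷ h) px

  zip-distinct : ∀ (x : A) xs z → Unique (x ∷ xs) → z ∉ x ∷ xs →
    All (λ e → proj₁ e ≢ proj₂ e) (zip (x ∷ xs) (xs ++ z ∷ []))
  zip-distinct x [] z u z∉ = (λ { refl → z∉ (here refl) }) ∷ []
  zip-distinct x (y ∷ ys) z ((x≢y ∷ _) ∷ u) z∉ = x≢y ∷ zip-distinct y ys z u (z∉ ∘ there)

  cycEdges-distinct : ∀ {c : List A} → 3 ≤ length c → Unique c → All (λ e → proj₁ e ≢ proj₂ e) (cycEdges c)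
  cycEdges-distinct {x ∷ []} (s≤s ()) u
  cycEdges-distinct {x ∷ y ∷ ys} len (x∉ ∷ u) =
    All.head x∉ ∷ zip-distinct y ys x u (Allₚ.All¬⇒¬Any x∉)

  zip-constant : ∀ {B : Set} (f : A → B) x xs z →
    All (λ e → f (proj₁ e) ≡ f (proj₂ e)) (zip (x ∷ xs) (xs ++ z ∷ [])) → All (λ v → f v ≡ f x) (x ∷ xs)
  zip-constant f x [] z h = refl ∷ []
  zip-constant f x (y ∷ ys) z (eq ∷ h) = refl ∷ All.map (λ p → trans p (sym eq)) (zip-constant f y ys z h)

AllPairs-++⁻ : ∀ {A : Set} {R : A → A → Set} xs {ys} → AllPairs R (xs ++ ys) →
  AllPairs R xs × AllPairs R ys × (∀ {x y} → x ∈ xs → y ∈ ys → R x y)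
AllPairs-++⁻ [] h = [] , h , λ ()
AllPairs-++⁻ (x ∷ xs) (h ∷ hs) with Allₚ.++⁻ xs h | AllPairs-++⁻ xs hs
... | hx , hy | px , py , r = hx ∷ px , py , λ { (here refl) y∈ → All.lookup hy y∈ ; (there x∈) y∈ → r x∈ y∈ }

-- Skeletons of canonical covers

module Skeletons {n t : ℕ} (G : Graph n) (part : Fin n → Fin t)
  (clique : ∀ u v → part u ≡ part v → u ≢ v → adj G u v ≡ true) where

  Edge : Set
  Edge = Fin n × Fin n

  Intra : Edge → Set
  Intra (u , v) = part u ≡ part v

  EndOf : Fin n → Edge → Set
  EndOf w (u , v) = u ≡ w ⊎ v ≡ w

  Adjacent : Edge → Set
  Adjacent (u , v) = adj G u v ≡ true

  between : Fin t → Fin t → Edge → Bool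
  between i j e = ((part (proj₁ e) ==F i) ∧ (part (proj₂ e) ==F j)) ∨
                  ((part (proj₁ e) ==F j) ∧ (part (proj₂ e) ==F i))

  edges : List (List (Fin n)) → List Edge
  edges cs = concat (map cycEdges cs)

  HasIntra : Fin t → List Edge → Set
  HasIntra i es = ∃ λ e → e ∈ es × part (proj₁ e) ≡ i × part (proj₂ e) ≡ i

  between-intra : ∀ {i j} → i ≢ j → ∀ e → Intra e → between i j e ≡ false
  between-intra {i} {j} i≢j (u , v) eq rewrite eq with part v ≟ i | part v ≟ j
  ... | yes refl | yes refl = contradiction refl i≢j
  ... | yes _ | no _ = refl
  ... | no _ | yes _ = refl
  ... | no _ | no _ = refl

  between-ends : ∀ u v → between (part u) (part v) (u , v) ≡ true
  between-ends u v rewrite ≡⇒==F {i = part u} refl | ≡⇒==F {i = part v} refl = refl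

  Crossing : List (Fin n) → Set
  Crossing c = ∃₂ λ i j → i ≢ j × 1 ≤ crossCount part i j c

  intra⇒¬Crossing : ∀ c → All Intra (cycEdges c) → ¬ Crossing c
  intra⇒¬Crossing c h (i , j , i≢j , le) =
    <⇒≱ le (≤-reflexive (countL-zero (between i j) (All.map (λ {e} → between-intra i≢j e) h)))

  record Skeleton (S : Fin n → Bool) (cs : List (List (Fin n))) : Set where
    field
      long     : All (λ c → 3 ≤ length c) cs
      disjoint : Unique (concat cs)
      inside   : ∀ {v} → v ∈ concat cs → S v ≡ true
      adjacent : All Adjacent (edges cs)
      crossing : All Crossing cs
      once     : ∀ i j → i ≢ j →
                 AllPairs (λ c d → ¬ (1 ≤ crossCount part i j c × 1 ≤ crossCount part i j d)) cs
      twice    : ∀ i j → i ≢ j → All (λ c → crossCount part i j c ≤ 2) cs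

  open Skeleton

  edges-↭ : ∀ {cs ds} → cs ↭ ds → edges cs ↭ edges ds
  edges-↭ σ = concat-↭ (↭-map⁺ cycEdges σ)

  Skeleton-resp-↭ : ∀ {S cs ds} → cs ↭ ds → Skeleton S cs → Skeleton S ds
  Skeleton-resp-↭ σ sk = record
    { long     = All-resp-↭ σ (long sk)
    ; disjoint = Unique-resp-↭ (concat-↭ σ) (disjoint sk)
    ; inside   = inside sk ∘ ∈-resp-↭ (↭-sym (concat-↭ σ))
    ; adjacent = All-resp-↭ (edges-↭ σ) (adjacent sk)
    ; crossing = All-resp-↭ σ (crossing sk)
    ; once     = λ i j i≢j → AllPairs-resp-↭ (λ ¬p (p , q) → ¬p (q , p)) σ (once sk i j i≢j)
    ; twice    = λ i j i≢j → All-resp-↭ σ (twice sk i j i≢j)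
    }

  -- `crossing`, `once` and `twice` depend on a cycle only through its cross counts, so equal counts
  -- transfer all three.
  Skeleton-replace : ∀ {S c d cs} → Skeleton S (c ∷ cs) →
    3 ≤ length d → Unique (d ++ concat cs) → All (λ v → S v ≡ true) d → All Adjacent (cycEdges d) →
    (∀ i j → i ≢ j → crossCount part i j d ≡ crossCount part i j c) → Skeleton S (d ∷ cs)
  Skeleton-replace {S} {c} {d} {cs} sk len uniq ins adjs same = record
    { long     = len ∷ All.tail (long sk)
    ; disjoint = uniq
    ; inside   = λ v∈ → [ All.lookup ins , (λ q → inside sk (∈-++⁺ʳ c q)) ]′ (∈-++⁻ d v∈)
    ; adjacent = Allₚ.++⁺ adjs (Allₚ.++⁻ʳ (cycEdges c) (adjacent sk))
    ; crossing = cross (crossing sk)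
    ; once     = λ i j i≢j → once′ i≢j (once sk i j i≢j)
    ; twice    = λ i j i≢j → subst (_≤ 2) (sym (same i j i≢j)) (All.head (twice sk i j i≢j)) ∷
                             All.tail (twice sk i j i≢j)
    }
    where
    cross : All Crossing (c ∷ cs) → All Crossing (d ∷ cs)
    cross ((i , j , i≢j , le) ∷ h) = (i , j , i≢j , subst (1 ≤_) (sym (same i j i≢j)) le) ∷ h
    once′ : ∀ {i j} → i ≢ j →
      AllPairs (λ c d → ¬ (1 ≤ crossCount part i j c × 1 ≤ crossCount part i j d)) (c ∷ cs) →
      AllPairs (λ c d → ¬ (1 ≤ crossCount part i j c × 1 ≤ crossCount part i j d)) (d ∷ cs)
    once′ {i} {j} i≢j (h ∷ hs) = All.map (λ ¬p (p , q) → ¬p (subst (1 ≤_) (same i j i≢j) p , q)) h ∷ hs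

  edge-ends : ∀ cs {e} → e ∈ edges cs → proj₁ e ∈ concat cs × proj₂ e ∈ concat cs
  edge-ends cs e∈ with ∈-concat⁻′ (map cycEdges cs) e∈
  ... | _ , e∈c , c∈ with ∈-map⁻ cycEdges c∈
  ...   | c , c∈cs , refl with All.lookup (cycEdges-ends (All.tabulate (λ v∈ → v∈))) e∈c
  ...     | u∈ , v∈ = ∈-concat⁺′ u∈ c∈cs , ∈-concat⁺′ v∈ c∈cs

  -- Permuting the cycles and rotating one of them changes nothing that matters, so a given edge may
  -- be assumed to be the first edge of the first cycle.
  locate : ∀ {S cs u v} → Skeleton S cs → (u , v) ∈ edges cs →
    ∃₂ λ r ds → Skeleton S ((u ∷ v ∷ r) ∷ ds) × length cs ≡ suc (length ds) ×
      concat cs ↭ concat ((u ∷ v ∷ r) ∷ ds) × edges cs ↭ edges ((u ∷ v ∷ r) ∷ ds)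
  locate {S} {cs} {u} {v} sk e∈ with ∈-concat⁻′ (map cycEdges cs) e∈
  ... | _ , e∈c , c∈ with ∈-map⁻ cycEdges c∈
  ...   | c , c∈cs , refl with ∈⇒↭ c∈cs
  ...     | ds , σ with Skeleton-resp-↭ σ sk
  ...       | sk′ with rotate-to-edge c (All.head (long sk′)) e∈c
  ...         | r , σv , σe = r , ds ,
      Skeleton-replace sk′ (subst (3 ≤_) (↭-length σv) (All.head (long sk′)))
        (Unique-resp-↭ (++⁺ʳ (concat ds) σv) (disjoint sk′))
        (All-resp-↭ σv (All.tabulate (λ v∈ → inside sk′ (∈-++⁺ˡ v∈))))
        (All-resp-↭ σe (Allₚ.++⁻ˡ (cycEdges c) (adjacent sk′)))
        (λ i j _ → countL-↭ (between i j) (↭-sym σe)) ,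
      ↭-length σ ,
      ↭-trans (concat-↭ σ) (++⁺ʳ (concat ds) σv) ,
      ↭-trans (edges-↭ σ) (++⁺ʳ (edges ds) σe)

  Avail? : (S : Fin n → Bool) (i : Fin t) (X : List (Fin n)) → ∀ v → Dec (S v ≡ true × part v ≡ i × v ∉ X)
  Avail? S i X v = (S v ≟ᵇ true) ×-dec ((part v ≟ i) ×-dec ¬? (v ∈? X))

  avail : (Fin n → Bool) → Fin t → List (Fin n) → List (Fin n)
  avail S i X = filter (Avail? S i X) (allFin n)

  avail-unique : ∀ S i X → Unique (avail S i X)
  avail-unique S i X = Uniqueₚ.filter⁺ (Avail? S i X) (Uniqueₚ.allFin⁺ n)

  ∈-avail⁺ : ∀ {S i X v} → S v ≡ true → part v ≡ i → v ∉ X → v ∈ avail S i X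
  ∈-avail⁺ {S} {i} {X} p q r = ∈-filter⁺ (Avail? S i X) (∈-allFin _) (p , q , r)

  ∈-avail⁻ : ∀ {S i X v} → v ∈ avail S i X → S v ≡ true × part v ≡ i × v ∉ X
  ∈-avail⁻ {S} {i} {X} v∈ = proj₂ (∈-filter⁻ (Avail? S i X) {xs = allFin n} v∈)

  length-≤-avail : ∀ {S i X xs} → Unique xs → (∀ {v} → v ∈ xs → S v ≡ true × part v ≡ i × v ∉ X) →
    length xs ≤ length (avail S i X)
  length-≤-avail uniq h = pigeonhole {R = _≡_} uniq
    (λ v∈ → let (p , q , r) = h v∈ in _ , ∈-avail⁺ p q r , refl) (λ { refl refl → refl })

  avail-mono : ∀ {S i X Y} → (∀ {v} → part v ≡ i → v ∈ Y → v ∈ X) →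
    length (avail S i X) ≤ length (avail S i Y)
  avail-mono {S} {i} {X} sub = length-≤-avail (avail-unique S i X)
    (λ v∈ → let (p , q , r) = ∈-avail⁻ v∈ in p , q , r ∘ sub q)

  occ : Fin t → List (Fin n) → List (Fin n)
  occ i X = filter (λ v → part v ≟ i) X

  count-≤-avail+occ : ∀ {S i} {f : Fin n → Bool} X → (∀ {v} → f v ≡ true → S v ≡ true × part v ≡ i) →
    count f ≤ length (avail S i X) + length (occ i X)
  count-≤-avail+occ {S} {i} {f} X h = subst (count f ≤_) (length-++ (avail S i X)) (count-≤-length sub)
    where
    sub : ∀ {v} → f v ≡ true → v ∈ avail S i X ++ occ i X
    sub {v} fv with v ∈? X
    ... | yes v∈ = ∈-++⁺ʳ (avail S i X) (∈-filter⁺ (λ v → part v ≟ i) v∈ (proj₂ (h fv)))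
    ... | no v∉ = ∈-++⁺ˡ (∈-avail⁺ (proj₁ (h fv)) (proj₂ (h fv)) v∉)

  -- What remains of a canonical cover with vertex set S after forgetting the cycles inside a single
  -- part: those parts are listed in is, and fill says that no vertex of another part is lost for good.
  record State (S : Fin n → Bool) (is : List (Fin t)) (cs : List (List (Fin n))) : Set where
    field
      skeleton : Skeleton S cs
      room     : ∀ {i} → i ∈ is → 3 ≤ length (avail S i (concat cs))
      fill     : ∀ {i} → i ∉ is →
                 (∀ v → part v ≡ i → S v ≡ true → v ∈ concat cs) ⊎ HasIntra i (edges cs)

  open State

  State-resp : ∀ {S is cs ds} → Skeleton S ds → concat cs ↭ concat ds → edges cs ↭ edges ds →
    State S is cs → State S is ds
  State-resp sk σ τ st = record
    { skeleton = sk
    ; room = λ i∈ → ≤-trans (room st i∈) (avail-mono (λ _ → ∈-resp-↭ (↭-sym σ)))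
    ; fill = λ i∉ → case fill st i∉ of λ
        { (inj₁ all) → inj₁ (λ v p s → ∈-resp-↭ σ (all v p s))
        ; (inj₂ (e , e∈ , pq)) → inj₂ (e , ∈-resp-↭ τ e∈ , pq) }
    }

  State-locate : ∀ {S is cs u v} → State S is cs → (u , v) ∈ edges cs →
    ∃₂ λ r ds → State S is ((u ∷ v ∷ r) ∷ ds) × length cs ≡ suc (length ds) ×
      concat cs ↭ concat ((u ∷ v ∷ r) ∷ ds) × edges cs ↭ edges ((u ∷ v ∷ r) ∷ ds)
  State-locate st e∈ with locate (skeleton st) e∈
  ... | r , ds , sk , len , σ , τ = r , ds , State-resp sk σ τ st , len , σ , τ

  -- Deleting vertices that meet no cross edge

  Tight : List (List (Fin n)) → Set
  Tight cs = All (λ w → Any (λ e → ¬ Intra e × EndOf w e) (edges cs)) (concat cs)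

  -- Quantifying over all tests that vanish inside parts covers at once the counts between two parts
  -- and the later count of cross edges not inside U.
  SameCross : List Edge → List Edge → Set
  SameCross es fs = ∀ (f : Edge → Bool) → (∀ e → Intra e → f e ≡ false) → countL f es ≡ countL f fs

  -- Both neighbours of `w` on the cycle lie in its part, so the clique supplies the shortcut. A
  -- triangle through `w` would lie in one part, against `crossing`, so at least three vertices
  -- remain. The shortcut is itself an edge inside the part, which gives `fill` for the dropped
  -- vertex.
  shorten : ∀ {S is p w r ds} → State S is ((p ∷ w ∷ r) ∷ ds) →
    (∀ {e} → e ∈ cycEdges (p ∷ w ∷ r) → EndOf w e → Intra e) →
    ∃ λ c → State S is (c ∷ ds) × w ∷ c ↭ p ∷ w ∷ r × SameCross (edges (c ∷ ds)) (edges ((p ∷ w ∷ r) ∷ ds))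
  shorten {p = p} {w} {[]} st h = contradiction (All.head (long (skeleton st))) λ { (s≤s (s≤s ())) }
  shorten {p = p} {w} {y ∷ []} st h =
    contradiction (All.head (crossing (skeleton st)))
      (intra⇒¬Crossing (p ∷ w ∷ y ∷ []) (pw ∷ wy ∷ sym (trans pw wy) ∷ []))
    where
    pw = h (here refl) (inj₂ refl)
    wy = h (there (here refl)) (inj₁ refl)
  shorten {S} {is} {p} {w} {y ∷ z ∷ r} {ds} st h = p ∷ y ∷ z ∷ r ,
    record { skeleton = sk ; room = room′ ; fill = fill′ } ,
    swap w p ↭-refl , same ds
    where
    pw : part p ≡ part w
    pw = h (here refl) (inj₂ refl)
    wy : part w ≡ part y
    wy = h (there (here refl)) (inj₁ refl)
    clipped : SameCross (cycEdges (p ∷ y ∷ z ∷ r)) (cycEdges (p ∷ w ∷ y ∷ z ∷ r))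
    clipped f z rewrite z (p , w) pw | z (w , y) wy | z (p , y) (trans pw wy) = refl
    same : ∀ ds → SameCross (edges ((p ∷ y ∷ z ∷ r) ∷ ds)) (edges ((p ∷ w ∷ y ∷ z ∷ r) ∷ ds))
    same ds f z rewrite z (p , w) pw | z (w , y) wy | z (p , y) (trans pw wy) = refl
    old = skeleton st
    keep : ∀ {v} → v ∈ (p ∷ y ∷ z ∷ r) ++ concat ds → v ∈ (p ∷ w ∷ y ∷ z ∷ r) ++ concat ds
    keep (here eq) = here eq
    keep (there v∈) = there (there v∈)
    uniq : Unique ((p ∷ y ∷ z ∷ r) ++ concat ds)
    uniq with disjoint old
    ... | (_ ∷ p∉) ∷ _ ∷ u = p∉ ∷ u
    path-adj : All Adjacent (cycEdges (p ∷ y ∷ z ∷ r))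
    path-adj with Allₚ.++⁻ˡ (cycEdges (p ∷ w ∷ y ∷ z ∷ r)) (adjacent old) | disjoint old
    ... | _ ∷ _ ∷ a | (_ ∷ p≢y ∷ _) ∷ _ = clique p y (trans pw wy) p≢y ∷ a
    sk : Skeleton S ((p ∷ y ∷ z ∷ r) ∷ ds)
    sk = Skeleton-replace old (s≤s (s≤s (s≤s z≤n))) uniq
      (All.tabulate (λ v∈ → inside old (keep (∈-++⁺ˡ v∈)))) path-adj
      (λ i j i≢j → clipped (between i j) (between-intra i≢j))
    room′ : ∀ {i} → i ∈ is → 3 ≤ length (avail S i ((p ∷ y ∷ z ∷ r) ++ concat ds))
    room′ i∈ = ≤-trans (room st i∈) (avail-mono (λ _ → keep))
    fill′ : ∀ {i} → i ∉ is → (∀ v → part v ≡ i → S v ≡ true → v ∈ (p ∷ y ∷ z ∷ r) ++ concat ds) ⊎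
      HasIntra i (edges ((p ∷ y ∷ z ∷ r) ∷ ds))
    fill′ {i} i∉ with i ≟ part w
    ... | yes refl = inj₂ ((p , y) , here refl , pw , sym wy)
    ... | no i≢ with fill st i∉
    ...   | inj₁ all = inj₁ (λ v q s → drop (λ { refl → i≢ (sym q) }) (all v q s))
      where
      drop : ∀ {v} → v ≢ w → v ∈ (p ∷ w ∷ y ∷ z ∷ r) ++ concat ds → v ∈ (p ∷ y ∷ z ∷ r) ++ concat ds
      drop v≢ (here eq) = here eq
      drop v≢ (there (here eq)) = contradiction eq v≢
      drop v≢ (there (there v∈)) = there v∈
    ...   | inj₂ (e , here refl , _ , q) = contradiction (sym q) i≢
    ...   | inj₂ (e , there (here refl) , q , _) = contradiction (sym q) i≢
    ...   | inj₂ (e , there (there e∈) , pq) = inj₂ (e , there e∈ , pq)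

  intra? : ∀ e → Dec (Intra e)
  intra? (u , v) = part u ≟ part v

  exposed? : ∀ cs w → Dec (Any (λ e → ¬ Intra e × EndOf w e) (edges cs))
  exposed? cs w = any? (λ e → ¬? (intra? e) ×-dec ((proj₁ e ≟ w) ⊎-dec (proj₂ e ≟ w))) (edges cs)

  Shortening : (S : Fin n → Bool) (is : List (Fin t)) (cs ds : List (List (Fin n))) → Set
  Shortening S is cs ds = State S is ds × length ds ≡ length cs × SameCross (edges ds) (edges cs)

  remove : ∀ {S is cs w} → State S is cs → w ∈ concat cs →
    ¬ Any (λ e → ¬ Intra e × EndOf w e) (edges cs) →
    ∃ λ ds → Shortening S is cs ds × suc (length (concat ds)) ≡ length (concat cs)
  remove {cs = cs} {w} st w∈ hidden with ∈-concat⁻′ cs w∈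
  ... | c , w∈c , c∈cs with in-edge w∈c
  ...   | p , e∈c with State-locate st (∈-concat⁺′ e∈c (∈-map⁺ cycEdges c∈cs))
  ...     | r , ds , st′ , len , σ , τ with shorten st′ intra
    where
    intra : ∀ {e} → e ∈ cycEdges (p ∷ w ∷ r) → EndOf w e → Intra e
    intra {e} e∈ end with intra? e
    ... | yes i = i
    ... | no ¬i = contradiction (lose (∈-resp-↭ (↭-sym τ) (∈-++⁺ˡ e∈)) (¬i , end)) hidden
  ...       | d , st″ , σ′ , same = d ∷ ds ,
      (st″ , sym len , λ f z → trans (same f z) (countL-↭ f (↭-sym τ))) ,
      trans (↭-length (++⁺ʳ (concat ds) σ′)) (sym (↭-length σ))

  tighten : ∀ {S is cs} → State S is cs → ∃ λ ds → Shortening S is cs ds × Tight ds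
  tighten st = go _ st refl
    where
    go : ∀ {S is cs} m → State S is cs → length (concat cs) ≡ m → ∃ λ ds → Shortening S is cs ds × Tight ds
    go {cs = cs} m st eq with All.all? (exposed? cs) (concat cs)
    ... | yes tight = cs , (st , refl , λ _ _ → refl) , tight
    ... | no ¬tight with find (Allₚ.¬All⇒Any¬ (exposed? cs) (concat cs) ¬tight)
    ...   | w , w∈ , hidden with remove st w∈ hidden
    go zero st eq | no _ | _ | ds , _ , dec = contradiction (trans dec eq) λ ()
    go (suc m) st eq | no _ | _ | ds , (st′ , len , same) , dec with go m st′ (suc-injective (trans dec eq))
    ... | es , (st″ , len′ , same′) , tight =
      es , (st″ , trans len′ len , λ f z → trans (same′ f z) (same f z)) , tight

  -- Replacing an edge by a path

  -- The common form of all insertions: `u v` becomes the path through `ps` with edges `new`. If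
  -- `u v` was the edge that `fill` relied on, `stays` provides a substitute on the path. Free
  -- vertices are spent, so `room` is left to the caller.
  splice : ∀ {S is cs u v} ps new → State S is cs → (u , v) ∈ edges cs →
    (∀ r → cycEdges (u ∷ ps ++ v ∷ r) ≡ new ++ zip (v ∷ r) (r ++ u ∷ [])) →
    All Adjacent new →
    (∀ i j → i ≢ j → countL (between i j) new ≡ countL (between i j) ((u , v) ∷ [])) →
    Unique ps → All (λ w → w ∉ concat cs × S w ≡ true) ps →
    (part u ≡ part v → HasIntra (part u) new) →
    (∀ {i} → i ∈ is → 3 ≤ length (avail S i (ps ++ concat cs))) →
    ∃ λ ds → State S is ds × length ds ≡ length cs × concat ds ↭ ps ++ concat cs ×
      ∃ λ es → edges ds ↭ new ++ es × edges cs ↭ (u , v) ∷ es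
  splice {S} {is} {cs} {u} {v} ps new st e∈ new-edges adjs same uniq fresh stays room′
    with State-locate st e∈
  ... | r , ds , st′ , len , σ , τ = (u ∷ ps ++ v ∷ r) ∷ ds ,
      record { skeleton = sk ; room = room″ ; fill = fill′ } , sym len , σ′ ,
      zip (v ∷ r) (r ++ u ∷ []) ++ edges ds , τ′ , τ
    where
    old = skeleton st′
    σc : u ∷ ps ++ v ∷ r ↭ ps ++ u ∷ v ∷ r
    σc = ↭-sym (shift u ps (v ∷ r))
    σ₁ : (u ∷ ps ++ v ∷ r) ++ concat ds ↭ ps ++ (u ∷ v ∷ r) ++ concat ds
    σ₁ = ↭-trans (++⁺ʳ (concat ds) σc) (↭-reflexive (++-assoc ps (u ∷ v ∷ r) (concat ds)))
    σ′ : (u ∷ ps ++ v ∷ r) ++ concat ds ↭ ps ++ concat cs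
    σ′ = ↭-trans σ₁ (++⁺ˡ ps (↭-sym σ))
    τ′ : edges ((u ∷ ps ++ v ∷ r) ∷ ds) ↭ new ++ zip (v ∷ r) (r ++ u ∷ []) ++ edges ds
    τ′ = ↭-reflexive (trans (cong (_++ edges ds) (new-edges r)) (++-assoc new _ (edges ds)))
    len≥3 : 3 ≤ length (u ∷ ps ++ v ∷ r)
    len≥3 = ≤-trans (All.head (long old)) (subst (length (u ∷ v ∷ r) ≤_)
      (trans (sym (length-++ ps)) (sym (↭-length σc))) (m≤n+m _ (length ps)))
    uniq′ : Unique ((u ∷ ps ++ v ∷ r) ++ concat ds)
    uniq′ = Unique-resp-↭ (↭-sym σ′) (Uniqueₚ.++⁺ uniq (disjoint (skeleton st))
      (λ (w∈ps , w∈cs) → proj₁ (All.lookup fresh w∈ps) w∈cs))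
    inside′ : ∀ {w} → w ∈ u ∷ ps ++ v ∷ r → S w ≡ true
    inside′ w∈ with ∈-++⁻ ps (∈-resp-↭ σc w∈)
    ... | inj₁ p = proj₂ (All.lookup fresh p)
    ... | inj₂ q = inside old (∈-++⁺ˡ q)
    same′ : ∀ i j → i ≢ j → crossCount part i j (u ∷ ps ++ v ∷ r) ≡ crossCount part i j (u ∷ v ∷ r)
    same′ i j i≢j =
      trans (cong (countL (between i j)) (new-edges r))
        (trans (countL-++ (between i j) new)
          (trans (cong (_+ _) (same i j i≢j))
            (sym (countL-++ (between i j) ((u , v) ∷ []) {zip (v ∷ r) (r ++ u ∷ [])}))))
    adjs′ : All Adjacent (cycEdges (u ∷ ps ++ v ∷ r))
    adjs′ = subst (All Adjacent) (sym (new-edges r))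
      (Allₚ.++⁺ adjs (All.tail (Allₚ.++⁻ˡ (cycEdges (u ∷ v ∷ r)) (adjacent old))))
    sk : Skeleton S ((u ∷ ps ++ v ∷ r) ∷ ds)
    sk = Skeleton-replace old len≥3 uniq′ (All.tabulate inside′) adjs′ same′
    room″ : ∀ {i} → i ∈ is → 3 ≤ length (avail S i ((u ∷ ps ++ v ∷ r) ++ concat ds))
    room″ i∈ = ≤-trans (room′ i∈) (avail-mono (λ _ → ∈-resp-↭ σ′))
    fill′ : ∀ {i} → i ∉ is → (∀ w → part w ≡ i → S w ≡ true → w ∈ (u ∷ ps ++ v ∷ r) ++ concat ds) ⊎
      HasIntra i (edges ((u ∷ ps ++ v ∷ r) ∷ ds))
    fill′ i∉ with fill st i∉
    ... | inj₁ all = inj₁ (λ w p s → ∈-resp-↭ (↭-sym σ′) (∈-++⁺ʳ ps (all w p s)))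
    ... | inj₂ (e , e∈ , p , q) with ∈-resp-↭ τ e∈
    ...   | there e∈′ = inj₂ (e , ∈-resp-↭ (↭-sym τ′) (∈-++⁺ʳ new e∈′) , p , q)
    ...   | here refl with stays (trans p (sym q))
    ...     | f , f∈ , p′ , q′ =
      inj₂ (f , ∈-resp-↭ (↭-sym τ′) (∈-++⁺ˡ f∈) , trans p′ p , trans q′ p)

  -- From states back to covers

  open import Data.List.Membership.DecPropositional (_≟_ {t}) using () renaming (_∈?_ to _∈ᵗ?_)

  -- As `w` is uncovered, `fill` must yield an edge inside its part, and the clique allows `w`
  -- between its ends. Parts in `is` lose no free vertex.
  insert : ∀ {S is cs} → State S is cs → ∀ w → S w ≡ true → part w ∉ is →
    ∃ λ ds → State S is ds × length ds ≡ length cs ×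
      (∀ {v} → v ∈ concat cs → v ∈ concat ds) × w ∈ concat ds
  insert {S} {is} {cs} st w Sw ∉is with w ∈? concat cs
  ... | yes w∈ = cs , st , refl , id , w∈
  ... | no w∉ with fill st ∉is
  ...   | inj₁ all = contradiction (all w refl Sw) w∉
  ...   | inj₂ ((x , y) , e∈ , px , py) with edge-ends cs e∈
  ...     | x∈ , y∈ with splice (w ∷ []) ((x , w) ∷ (w , y) ∷ []) st e∈ (λ r → refl)
    (clique x w px (λ { refl → w∉ x∈ }) ∷ clique w y (sym py) (λ { refl → w∉ y∈ }) ∷ [])
    (λ i j i≢j → trans
      (countL-zero (between i j) (between-intra i≢j (x , w) px ∷ between-intra i≢j (w , y) (sym py) ∷ []))
      (sym (countL-zero (between i j) (between-intra i≢j (x , y) (trans px (sym py)) ∷ []))))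
    ([] ∷ []) ((w∉ , Sw) ∷ []) (λ _ → (x , w) , here refl , refl , sym px)
    (λ i∈ → ≤-trans (room st i∈) (avail-mono (λ { refl (here refl) → contradiction i∈ ∉is ; _ (there v∈) → v∈ })))
  ...       | ds , st′ , len , σ , _ =
    ds , st′ , len , (λ v∈ → ∈-resp-↭ (↭-sym σ) (there v∈)) , ∈-resp-↭ (↭-sym σ) (here refl)

  saturate : ∀ {S is cs} → State S is cs → ∀ ws →
    ∃ λ ds → State S is ds × length ds ≡ length cs × (∀ {v} → v ∈ concat cs → v ∈ concat ds) ×
      (∀ {w} → w ∈ ws → S w ≡ true → part w ∉ is → w ∈ concat ds)
  saturate {cs = cs} st [] = cs , st , refl , id , λ ()
  saturate {S} {is} st (w ∷ ws) with saturate st ws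
  ... | ds , st′ , len , grow , cov with (S w ≟ᵇ true) ×-dec ¬? (part w ∈ᵗ? is)
  ...   | no ¬p = ds , st′ , len , grow ,
    λ { (here refl) s ∉is → contradiction (s , ∉is) ¬p ; (there w∈) s ∉is → cov w∈ s ∉is }
  ...   | yes (s , ∉is) with insert st′ w s ∉is
  ...     | es , st″ , len′ , grow′ , w∈ = es , st″ , trans len′ len , grow′ ∘ grow ,
    λ { (here refl) _ _ → w∈ ; (there v∈) s ∉is → grow′ (cov v∈ s ∉is) }

  State⇒cover : ∀ {S is cs} → Unique is → State S is cs →
    HasCanonicalCover G part S (length cs + length is)
  State⇒cover {S} {is} {cs} is-unique st with saturate st (allFin n)
  ... | ds , st′ , len , _ , cov = ds ++ map inner is ,
      (Allₚ.++⁺ (All.tabulate outer-cycle) (Allₚ.map⁺ (All.tabulate inner-cycle)) , uniq , covers) ,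
      ((λ i → AllPairs⇒AtMostOne (one-inside i)) ,
       (λ i j i≢j → AllPairs⇒AtMostOne (one-between i≢j) , twice′ i≢j)) ,
      trans (length-++ ds) (cong₂ _+_ len (length-map inner is))
    where
    sk = skeleton st′
    -- In a clique any three or more vertices, in any order, form a cycle, so one cycle takes all
    -- that is left over in part `i`.
    inner : Fin t → List (Fin n)
    inner i = avail S i (concat ds)
    inner-part : ∀ i → All (λ v → part v ≡ i) (inner i)
    inner-part i = All.tabulate (λ v∈ → proj₁ (proj₂ (∈-avail⁻ v∈)))
    inner-intra : ∀ i → All Intra (cycEdges (inner i))
    inner-intra i = All.map (λ (p , q) → trans p (sym q)) (cycEdges-ends (inner-part i))
    inner-uncrossed : ∀ {i j} → i ≢ j → ∀ k → crossCount part i j (inner k) ≡ 0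
    inner-uncrossed i≢j k = countL-zero _ (All.map (λ {e} → between-intra i≢j e) (inner-intra k))
    outer-cycle : ∀ {c} → c ∈ ds → IsCycle G S c
    outer-cycle {c} c∈ with ∈⇒↭ c∈
    ... | rest , σ with Skeleton-resp-↭ σ sk
    ...   | sk′ = All.head (long sk′) , proj₁ (AllPairs-++⁻ c (disjoint sk′)) ,
        All.tabulate (λ v∈ → inside sk′ (∈-++⁺ˡ v∈)) , Allₚ.++⁻ˡ (cycEdges c) (adjacent sk′)
    inner-cycle : ∀ {i} → i ∈ is → IsCycle G S (inner i)
    inner-cycle {i} i∈ = room st′ i∈ , avail-unique S i _ , All.tabulate (λ v∈ → proj₁ (∈-avail⁻ v∈)) ,
      All.zipWith (λ (eq , ne) → clique _ _ eq ne)
        (inner-intra i , cycEdges-distinct (room st′ i∈) (avail-unique S i _))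
    uniq : Unique (concat (ds ++ map inner is))
    uniq = subst Unique (concat-++ ds (map inner is))
      (Uniqueₚ.++⁺ (disjoint sk)
        (Uniqueₚ.concat⁺ (Allₚ.map⁺ (All.tabulate (λ {i} _ → avail-unique S i _)))
          (AllPairsₚ.map⁺ (AllPairs.map inner-apart is-unique)))
        apart)
      where
      inner-apart : ∀ {i j} → i ≢ j → ∀ {v} → ¬ (v ∈ inner i × v ∈ inner j)
      inner-apart {i} {j} i≢j (p , q) =
        i≢j (trans (sym (All.lookup (inner-part i) p)) (All.lookup (inner-part j) q))
      apart : ∀ {v} → ¬ (v ∈ concat ds × v ∈ concat (map inner is))
      apart (v∈ , v∈′) with ∈-concat⁻′ (map inner is) v∈′
      ... | _ , v∈c , c∈ with ∈-map⁻ inner c∈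
      ...   | i , _ , refl = proj₂ (proj₂ (∈-avail⁻ {S} {i} v∈c)) v∈
    covers : ∀ v → S v ≡ true → v ∈ concat (ds ++ map inner is)
    covers v s = subst (v ∈_) (concat-++ ds (map inner is)) covered
      where
      covered : v ∈ concat ds ++ concat (map inner is)
      covered with v ∈? concat ds
      ... | yes v∈ = ∈-++⁺ˡ v∈
      ... | no v∉ with part v ∈ᵗ? is
      ...   | yes i∈ = ∈-++⁺ʳ (concat ds) (∈-concat⁺′ (∈-avail⁺ s refl v∉) (∈-map⁺ inner i∈))
      ...   | no i∉ = contradiction (cov (∈-allFin v) s i∉) v∉
    outer-not-inside : ∀ {c} → c ∈ ds → ∀ i → ¬ All (λ v → part v ≡ i) c
    outer-not-inside {c} c∈ i h = intra⇒¬Crossing c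
      (All.map (λ (p , q) → trans p (sym q)) (cycEdges-ends h)) (All.lookup (crossing sk) c∈)
    -- An empty list would lie in every part; `room` rules that out.
    inner-part-unique : ∀ {i j} → i ∈ is → All (λ v → part v ≡ j) (inner i) → i ≡ j
    inner-part-unique {i} i∈ h with inner i | room st′ i∈ | inner-part i
    inner-part-unique i∈ (q ∷ _) | _ ∷ _ | _ | p ∷ _ = trans (sym p) q
    one-inside : ∀ i → AllPairs (λ c d → ¬ (All (λ v → part v ≡ i) c × All (λ v → part v ≡ i) d))
      (ds ++ map inner is)
    one-inside i = AllPairsₚ.++⁺ {xs = ds}
      (vacuous ds (λ c∈ → outer-not-inside c∈ i))
      (AllPairsₚ.map⁺ (distinct is id is-unique))
      (All.tabulate (λ c∈ → All.tabulate (λ _ (p , _) → outer-not-inside c∈ i p)))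
      where
      vacuous : ∀ {P : List (Fin n) → Set} cs → (∀ {c} → c ∈ cs → ¬ P c) → AllPairs (λ c d → ¬ (P c × P d)) cs
      vacuous [] h = []
      vacuous (c ∷ cs) h = All.tabulate (λ _ (p , _) → h (here refl) p) ∷ vacuous cs (h ∘ there)
      distinct : ∀ js → (∀ {j} → j ∈ js → j ∈ is) → Unique js →
        AllPairs (λ j k → ¬ (All (λ v → part v ≡ i) (inner j) × All (λ v → part v ≡ i) (inner k))) js
      distinct [] sub [] = []
      distinct (j ∷ js) sub (j∉ ∷ u) =
        All.tabulate (λ k∈ (p , q) → All.lookup j∉ k∈
          (trans (inner-part-unique (sub (here refl)) p) (sym (inner-part-unique (sub (there k∈)) q)))) ∷
        distinct js (sub ∘ there) u
    one-between : ∀ {i j} → i ≢ j →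
      AllPairs (λ c d → ¬ (1 ≤ crossCount part i j c × 1 ≤ crossCount part i j d)) (ds ++ map inner is)
    one-between {i} {j} i≢j = AllPairsₚ.++⁺ (once sk i j i≢j)
      (AllPairsₚ.map⁺ (AllPairs.map (λ {a} _ (p , _) → uncrossed a p) is-unique))
      (All.tabulate (λ _ → Allₚ.map⁺ (All.tabulate (λ {a} _ (_ , q) → uncrossed a q))))
      where
      uncrossed : ∀ k → ¬ 1 ≤ crossCount part i j (inner k)
      uncrossed k le = <⇒≱ le (≤-reflexive (inner-uncrossed i≢j k))
    twice′ : ∀ {i j} → i ≢ j → All (λ c → crossCount part i j c ≤ 2) (ds ++ map inner is)
    twice′ {i} {j} i≢j = Allₚ.++⁺ (twice sk i j i≢j)
      (Allₚ.map⁺ (All.tabulate (λ {k} _ → subst (_≤ 2) (sym (inner-uncrossed i≢j k)) z≤n)))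

  -- From covers to states

  cycle-shape : ∀ c → 3 ≤ length c → Crossing c ⊎ ∃ λ i → All (λ v → part v ≡ i) c
  cycle-shape (x ∷ xs) len with any? (λ e → ¬? (intra? e)) (cycEdges (x ∷ xs))
  ... | yes a with find a
  ...   | (u , v) , e∈ , ne = inj₁ (part u , part v , ne , countL-pos⁺ (between (part u) (part v)) e∈ (between-ends u v))
  cycle-shape (x ∷ xs) len | no ¬a = inj₂ (part x , zip-constant part x xs x
    (All.map (λ {e} ¬¬i → decidable-stable (intra? e) ¬¬i) (Allₚ.¬Any⇒All¬ _ ¬a)))

  split-cycles : ∀ cs → All (λ c → 3 ≤ length c) cs →
    ∃₂ λ xs (ds : List (Fin t × List (Fin n))) → cs ↭ xs ++ map proj₂ ds × All Crossing xs ×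
      All (λ (i , c) → All (λ v → part v ≡ i) c) ds
  split-cycles [] [] = [] , [] , ↭-refl , [] , []
  split-cycles (c ∷ cs) (len ∷ h) with split-cycles cs h | cycle-shape c len
  ... | xs , ds , σ , cr , ins | inj₁ x = c ∷ xs , ds , prep c σ , x ∷ cr , ins
  ... | xs , ds , σ , cr , ins | inj₂ (i , p) = xs , (i , c) ∷ ds ,
    ↭-trans (prep c σ) (↭-sym (shift c xs (map proj₂ ds))) , cr , p ∷ ins

  cover⇒State : ∀ {S k} → HasCanonicalCover G part S k →
    ∃₂ λ is cs → Unique is × State S is cs × length cs + length is ≡ k
  cover⇒State {S} (cs , (cyc , uniq , cov) , (inn , btw) , refl) with split-cycles cs (All.map proj₁ cyc)
  ... | xs , ds , σ , cr , ins = map proj₁ ds , xs , AllPairsₚ.map⁺ (distinct ds ins inn′) ,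
      record { skeleton = sk ; room = room′ ; fill = fill′ } ,
      trans (cong (length xs +_) (trans (length-map proj₁ ds) (sym (length-map proj₂ ds))))
        (trans (sym (length-++ xs)) (sym (↭-length σ)))
    where
    cyc′ : All (IsCycle G S) (xs ++ map proj₂ ds)
    cyc′ = All-resp-↭ σ cyc
    cycx = Allₚ.++⁻ˡ xs cyc′
    cycd : All (λ d → IsCycle G S (proj₂ d)) ds
    cycd = Allₚ.map⁻ (Allₚ.++⁻ʳ xs cyc′)
    parted = AllPairs-++⁻ (concat xs) (subst Unique (sym (concat-++ xs (map proj₂ ds)))
      (Unique-resp-↭ (concat-↭ σ) uniq))
    sk : Skeleton S xs
    sk = record
      { long = All.map proj₁ cycx
      ; disjoint = proj₁ parted
      ; inside = λ v∈ → let (c , v∈c , c∈) = ∈-concat⁻′ xs v∈ in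
          All.lookup (proj₁ (proj₂ (proj₂ (All.lookup cycx c∈)))) v∈c
      ; adjacent = Allₚ.concat⁺ (Allₚ.map⁺ (All.map (λ c → proj₂ (proj₂ (proj₂ c))) cycx))
      ; crossing = cr
      ; once = λ i j i≢j → proj₁ (AllPairs-++⁻ xs (AllPairs-resp-↭ (λ ¬p (p , q) → ¬p (q , p)) σ
          (AtMostOne⇒AllPairs cs (proj₁ (btw i j i≢j)))))
      ; twice = λ i j i≢j → Allₚ.++⁻ˡ xs (All-resp-↭ σ (proj₂ (btw i j i≢j)))
      }
    inn′ : ∀ i → AllPairs (λ c d → ¬ (All (λ v → part v ≡ i) (proj₂ c) × All (λ v → part v ≡ i) (proj₂ d))) ds
    inn′ i = AllPairsₚ.map⁻ (proj₁ (proj₂ (AllPairs-++⁻ xs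
      (AllPairs-resp-↭ (λ ¬p (p , q) → ¬p (q , p)) σ (AtMostOne⇒AllPairs cs (inn i))))))
    distinct : ∀ ds → All (λ (i , c) → All (λ v → part v ≡ i) c) ds →
      (∀ i → AllPairs (λ c d → ¬ (All (λ v → part v ≡ i) (proj₂ c) × All (λ v → part v ≡ i) (proj₂ d))) ds) →
      AllPairs (λ c d → proj₁ c ≢ proj₁ d) ds
    distinct [] _ _ = []
    distinct ((i , c) ∷ ds) (p ∷ ps) h =
      All.tabulate (λ d∈ → λ { refl → All.lookup (AllPairs.head (h i)) d∈ (p , All.lookup ps d∈) }) ∷
      distinct ds ps (λ i → AllPairs.tail (h i))
    room′ : ∀ {i} → i ∈ map proj₁ ds → 3 ≤ length (avail S i (concat xs))
    room′ i∈ with ∈-map⁻ proj₁ i∈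
    ... | (i , c) , d∈ , refl with All.lookup cycd d∈
    ...   | len , u , inS , _ = ≤-trans len (length-≤-avail u (λ v∈ →
      All.lookup inS v∈ , All.lookup (All.lookup ins d∈) v∈ ,
      λ v∈′ → proj₂ (proj₂ parted) v∈′ (∈-concat⁺′ v∈ (∈-map⁺ proj₂ d∈)) refl))
    fill′ : ∀ {i} → i ∉ map proj₁ ds →
      (∀ v → part v ≡ i → S v ≡ true → v ∈ concat xs) ⊎ HasIntra i (edges xs)
    -- A vertex off the crossing cycles lies on a cycle inside its part, and that part is listed.
    -- The other alternative of `fill` arises only through later deletions.
    fill′ i∉ = inj₁ covered
      where
      covered : ∀ v → part v ≡ _ → S v ≡ true → v ∈ concat xs
      covered v p s with ∈-++⁻ (concat xs) (subst (v ∈_) (sym (concat-++ xs (map proj₂ ds)))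
        (∈-resp-↭ (concat-↭ σ) (cov v s)))
      ... | inj₁ v∈ = v∈
      ... | inj₂ v∈ with ∈-concat⁻′ (map proj₂ ds) v∈
      ...   | _ , v∈c , c∈ with ∈-map⁻ proj₂ c∈
      ...     | (j , c) , d∈ , refl = contradiction
        (subst (_∈ map proj₁ ds) (trans (sym (All.lookup (All.lookup ins d∈) v∈c)) p) (∈-map⁺ proj₁ d∈)) i∉

  -- Tight skeletons

  quotAdj⁺ : ∀ {i j u v} → part u ≡ i → part v ≡ j → i ≢ j → adj G u v ≡ true → quotAdj G part i j ≡ true
  quotAdj⁺ {i} {j} {u} {v} p q i≢j a rewrite ≢⇒==F i≢j =
    anyF⁺ u (anyF⁺ v (∧-true (≡⇒==F p) (∧-true (≡⇒==F q) a)))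

  countL-edges-zero : ∀ (p : Edge → Bool) cs → All (λ c → ¬ 1 ≤ countL p (cycEdges c)) cs →
    countL p (edges cs) ≡ 0
  countL-edges-zero p [] [] = refl
  countL-edges-zero p (c ∷ cs) (z ∷ zs)
    rewrite countL-++ p (cycEdges c) {edges cs} | n<1⇒n≡0 (≰⇒> z) = countL-edges-zero p cs zs

  -- At most one cycle contributes at all, and it contributes at most 2; this turns the clause about
  -- single cycles into a bound on all edges together.
  edges-once-twice : ∀ (p : Edge → Bool) cs →
    AllPairs (λ c d → ¬ (1 ≤ countL p (cycEdges c) × 1 ≤ countL p (cycEdges d))) cs →
    All (λ c → countL p (cycEdges c) ≤ 2) cs → countL p (edges cs) ≤ 2
  edges-once-twice p [] [] [] = z≤n
  edges-once-twice p (c ∷ cs) (h ∷ hs) (le ∷ les) rewrite countL-++ p (cycEdges c) {edges cs}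
    with 1 ≤? countL p (cycEdges c)
  ... | yes pos rewrite countL-edges-zero p cs (All.map (λ ¬b q → ¬b (pos , q)) h) | +-identityʳ (countL p (cycEdges c)) = le
  ... | no ¬pos rewrite n<1⇒n≡0 (≰⇒> ¬pos) = edges-once-twice p cs hs les

  -- Each vertex of part `i` in use is charged to a cross edge at it. A cross edge has only one end
  -- in part `i`, so the charging is injective. Labelled by the part at their other end, these edges
  -- use only neighbours of `i`, each at most twice.
  occ-≤-degree : ∀ {S cs} → Skeleton S cs → Tight cs → ∀ i → length (occ i (concat cs)) ≤ 2 * quotDeg G part i
  occ-≤-degree {cs = cs} sk tight i = begin
    length (occ i (concat cs))                 ≤⟨ occ≤es ⟩
    length es                                  ≤⟨ length-≤-labels other (elems (quotAdj G part i)) es nbr twice-each ⟩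
    2 * length (elems (quotAdj G part i))      ≡⟨ cong (2 *_) (count-elems (quotAdj G part i)) ⟨
    2 * quotDeg G part i                       ∎
    where
    open ≤-Reasoning
    At : Edge → Set
    At e = ¬ Intra e × (part (proj₁ e) ≡ i ⊎ part (proj₂ e) ≡ i)
    at? : ∀ e → Dec (At e)
    at? e = ¬? (intra? e) ×-dec ((part (proj₁ e) ≟ i) ⊎-dec (part (proj₂ e) ≟ i))
    es : List Edge
    es = filter at? (edges cs)
    other : Edge → Fin t
    other (u , v) = if part u ==F i then part v else part u
    other-ends : ∀ {e} → At e →
      (part (proj₁ e) ≡ i × other e ≡ part (proj₂ e)) ⊎ (part (proj₂ e) ≡ i × other e ≡ part (proj₁ e))
    other-ends {u , v} (cross , end) with part u ≟ i | end
    ... | yes p | _ = inj₁ (p , refl)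
    ... | no ¬p | inj₁ p = contradiction p ¬p
    ... | no _ | inj₂ q = inj₂ (q , refl)
    nbr : ∀ {e} → e ∈ es → other e ∈ elems (quotAdj G part i)
    nbr {u , v} e∈ with ∈-filter⁻ at? {xs = edges cs} e∈
    ... | e∈cs , at with other-ends at | All.lookup (adjacent sk) e∈cs
    ...   | inj₁ (p , eq) | a rewrite eq = ∈-elems⁺ (quotAdj⁺ p refl (λ i≡v → proj₁ at (trans p i≡v)) a)
    ...   | inj₂ (q , eq) | a rewrite eq =
      ∈-elems⁺ (quotAdj⁺ q refl (λ i≡u → proj₁ at (sym (trans q i≡u))) (trans (adj-sym G v u) a))
    between-other : ∀ {j} e → At e → (other e ==F j) ≡ true → between i j e ≡ true
    between-other {j} (u , v) at eq with ==F⇒≡ {i = other (u , v)} eq | other-ends at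
    ... | refl | inj₁ (p , q) rewrite q | ≡⇒==F p | ≡⇒==F {i = part v} refl = refl
    ... | refl | inj₂ (p , q) rewrite q | ≡⇒==F p | ≡⇒==F {i = part u} refl = ∨-zeroʳ _
    twice-each : ∀ {j} → j ∈ elems (quotAdj G part i) → countL (λ e → other e ==F j) es ≤ 2
    twice-each {j} j∈ = ≤-trans (countL-filter-≤ at? (edges cs) between-other)
      (edges-once-twice (between i j) cs (once sk i j i≢j) (twice sk i j i≢j))
      where
      i≢j : i ≢ j
      i≢j refl = true≢false (∈-elems⁻ {f = quotAdj G part i} j∈) irreflexive
        where
        irreflexive : quotAdj G part i i ≡ false
        irreflexive rewrite ≡⇒==F {i = i} refl = refl
    Serves : Fin n → Edge → Set
    Serves w e = EndOf w e × part w ≡ i × ¬ Intra e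
    serves-unique : ∀ {w w' e} → Serves w e → Serves w' e → w ≡ w'
    serves-unique (inj₁ refl , _) (inj₁ refl , _) = refl
    serves-unique (inj₁ refl , p , cross) (inj₂ refl , q , _) = contradiction (trans p (sym q)) cross
    serves-unique (inj₂ refl , p , cross) (inj₁ refl , q , _) = contradiction (trans q (sym p)) cross
    serves-unique (inj₂ refl , _) (inj₂ refl , _) = refl
    occ≤es : length (occ i (concat cs)) ≤ length es
    occ≤es = pigeonhole {R = Serves} (Uniqueₚ.filter⁺ (λ v → part v ≟ i) (disjoint sk)) serve serves-unique
      where
      serve : ∀ {w} → w ∈ occ i (concat cs) → ∃ λ e → e ∈ es × Serves w e
      serve w∈ with ∈-filter⁻ (λ v → part v ≟ i) {xs = concat cs} w∈
      ... | w∈cs , p with find (All.lookup tight w∈cs)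
      ...   | e , e∈ , cross , end = e , ∈-filter⁺ at? e∈ (cross , at end) , end , p , cross
        where
        at : EndOf _ e → part (proj₁ e) ≡ i ⊎ part (proj₂ e) ≡ i
        at (inj₁ refl) = inj₁ p
        at (inj₂ refl) = inj₂ p

  length-occ-++ : ∀ i xs ys → length (occ i (xs ++ ys)) ≡ length (occ i xs) + length (occ i ys)
  length-occ-++ i xs ys = trans (cong length (filter-++ (λ v → part v ≟ i) xs ys)) (length-++ (occ i xs))

  occ-distinct-≤1 : ∀ i {ps} → AllPairs (λ v w → part v ≢ part w) ps → length (occ i ps) ≤ 1
  occ-distinct-≤1 i [] = z≤n
  occ-distinct-≤1 i {p ∷ ps} (h ∷ hs) with part p ≟ i
  ... | no _ = occ-distinct-≤1 i hs
  ... | yes refl rewrite filter-none (λ v → part v ≟ i) {ps} (All.map ≢-sym h) = s≤s z≤n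

  -- Passing between G and H

  module Reduction (Δ : ℕ) (maxdeg : ∀ i → quotDeg G part i ≤ Δ) (C : Construction G part Δ) where

    open Construction C

    occ-≤-2Δ : ∀ {S cs} → Skeleton S cs → Tight cs → ∀ i → length (occ i (concat cs)) ≤ 2 * Δ
    occ-≤-2Δ sk tight i = ≤-trans (occ-≤-degree sk tight i) (*-monoʳ-≤ 2 (maxdeg i))

    M'⇒U : ∀ {u v} → M' u v ≡ true → U u ≡ true
    M'⇒U {u} {v} m = cong (_∨ Extra u) (anyF⁺ v (cong (_∨ Add v u) m))

    Add⇒U : ∀ {v w} → Add v w ≡ true → U w ≡ true
    Add⇒U {v} {w} a = cong (_∨ Extra w) (anyF⁺ v (∨-true⁺ʳ (M' w v) a))

    -- The cases are the two values of the minimum in `Extra-size`; in the first alternative every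
    -- vertex outside `base` was taken.
    full-or-big : ∀ i → (∀ v → part v ≡ i → U v ≡ true) ⊎
      (4 * Δ + 3 ≤ count (λ v → Extra v ∧ (part v ==F i)))
    full-or-big i with ≤-total (4 * Δ + 3) (count (λ v → (part v ==F i) ∧ not (base v)))
    ... | inj₁ le = inj₂ (≤-reflexive (sym (trans (Extra-size i) (m≤n⇒m⊓n≡m le))))
    ... | inj₂ ge = inj₁ full
      where
      new : ∀ v → Extra v ∧ (part v ==F i) ≡ true → (part v ==F i) ∧ not (base v) ≡ true
      new v h = ∧-true (∧-conicalʳ (Extra v) _ h) (cong not (Extra-new v (∧-conicalˡ _ _ h)))
      full : ∀ v → part v ≡ i → U v ≡ true
      full v p with base v in eq
      ... | true = refl
      ... | false = ∧-conicalˡ _ _ (count-saturated new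
        (≤-reflexive (sym (trans (Extra-size i) (m≥n⇒m⊓n≡n ge)))) v (∧-true (≡⇒==F p) (cong not eq)))

    -- Even with 4Δ vertices of the part in use, three of 4Δ + 3 would be free.
    big⇒room : ∀ {S i} X {f : Fin n → Bool} → (∀ {v} → f v ≡ true → S v ≡ true × part v ≡ i) →
      length (occ i X) ≤ 2 * Δ → 4 * Δ + 3 ≤ count f → 3 ≤ length (avail S i X)
    big⇒room {S} {i} X {f} h few big = +-cancelʳ-≤ (4 * Δ) 3 _ (begin
      3 + 4 * Δ                                  ≡⟨ +-comm 3 (4 * Δ) ⟩
      4 * Δ + 3                                  ≤⟨ big ⟩
      count f                                    ≤⟨ count-≤-avail+occ X h ⟩
      length (avail S i X) + length (occ i X)    ≤⟨ +-monoʳ-≤ (length (avail S i X)) (≤-trans few (*-monoˡ-≤ Δ {2} {4} (s≤s (s≤s z≤n)))) ⟩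
      length (avail S i X) + 4 * Δ               ∎)
      where open ≤-Reasoning

    Extra-in : ∀ {i v} → Extra v ∧ (part v ==F i) ≡ true → U v ≡ true × part v ≡ i
    Extra-in {i} {v} h = ∨-true⁺ʳ (base v) (∧-conicalˡ _ _ h) , ==F⇒≡ (∧-conicalʳ (Extra v) _ h)

    extend : ∀ {is cs} → State U is cs → Tight cs → State allV is cs
    extend {is} {cs} st tight = record
      { skeleton = record
          { long = long sk ; disjoint = disjoint sk ; inside = λ _ → refl ; adjacent = adjacent sk
          ; crossing = crossing sk ; once = once sk ; twice = twice sk }
      ; room = λ {i} i∈ → ≤-trans (room st i∈) (length-≤-avail (avail-unique U i _)
          (λ v∈ → refl , proj₂ (∈-avail⁻ v∈)))
      ; fill = fill′
      }
      where
      sk = skeleton st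
      fill′ : ∀ {i} → i ∉ is → (∀ v → part v ≡ i → allV v ≡ true → v ∈ concat cs) ⊎ HasIntra i (edges cs)
      fill′ {i} i∉ with fill st i∉
      ... | inj₂ intra = inj₂ intra
      ... | inj₁ all with full-or-big i
      ...   | inj₁ full = inj₁ (λ v p _ → all v p (full v p))
      -- Some vertex of U in this part is free, so `all` cannot hold.
      ...   | inj₂ big with avail U i (concat cs) in eq | big⇒room (concat cs) Extra-in (occ-≤-2Δ sk tight i) big
      ...     | v ∷ _ | _ =
        let (s , p , v∉) = ∈-avail⁻ (subst (v ∈_) (sym eq) (here refl)) in contradiction (all v p s) v∉

    bad : Edge → Bool
    bad (u , v) = not (part u ==F part v) ∧ not (U u ∧ U v)

    bad-intra : ∀ e → Intra e → bad e ≡ false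
    bad-intra (u , v) p rewrite ≡⇒==F p = refl

    bad-U : ∀ {u v} → U u ≡ true → U v ≡ true → bad (u , v) ≡ false
    bad-U {u} {v} p q rewrite p | q = ∧-zeroʳ (not (part u ==F part v))

    restrict : ∀ {is cs} → State allV is cs → Tight cs → countL bad (edges cs) ≡ 0 → State U is cs
    restrict {is} {cs} st tight none = record
      { skeleton = record
          { long = long sk ; disjoint = disjoint sk ; inside = inside′ ; adjacent = adjacent sk
          ; crossing = crossing sk ; once = once sk ; twice = twice sk }
      ; room = room′
      ; fill = λ i∉ → [ (λ all → inj₁ (λ v p _ → all v p refl)) , inj₂ ]′ (fill st i∉)
      }
      where
      sk = skeleton st
      inside′ : ∀ {w} → w ∈ concat cs → U w ≡ true
      inside′ {w} w∈ with find (All.lookup tight w∈)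
      ... | (u , v) , e∈ , cross , end with U u in pu | U v in pv | end
      ...   | true | true | inj₁ refl = pu
      ...   | true | true | inj₂ refl = pv
      ...   | true | false | _ = contradiction (countL-pos⁺ bad e∈ b) (<⇒≱ (≤-reflexive (cong suc none)))
        where
        b : bad (u , v) ≡ true
        b rewrite ≢⇒==F cross | pu | pv = refl
      ...   | false | _ | _ = contradiction (countL-pos⁺ bad e∈ b) (<⇒≱ (≤-reflexive (cong suc none)))
        where
        b : bad (u , v) ≡ true
        b rewrite ≢⇒==F cross | pu = refl
      room′ : ∀ {i} → i ∈ is → 3 ≤ length (avail U i (concat cs))
      room′ {i} i∈ with full-or-big i
      ... | inj₁ full = ≤-trans (room st i∈) (length-≤-avail (avail-unique allV i _)
          (λ {v} v∈ → full v (proj₁ (proj₂ (∈-avail⁻ v∈))) , proj₂ (∈-avail⁻ v∈)))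
      ... | inj₂ big = big⇒room (concat cs) Extra-in (occ-≤-2Δ sk tight i) big

    -- Moving the cross edges into U

    4+2Δ≤6Δ : 1 ≤ Δ → 4 + 2 * Δ ≤ 6 * Δ
    4+2Δ≤6Δ pos = ≤-trans (+-monoˡ-≤ (2 * Δ) (*-monoʳ-≤ 4 pos)) (≤-reflexive (sym (*-distribʳ-+ Δ 4 2)))

    cross⇒1≤Δ : ∀ {u v} → adj G u v ≡ true → part u ≢ part v → 1 ≤ Δ
    cross⇒1≤Δ {u} {v} a u≢v = ≤-trans
      (length-≤-count {xs = part v ∷ []} ([] ∷ []) (λ { (here refl) → quotAdj⁺ refl refl u≢v a }))
      (maxdeg (part u))

    -- The size bound serves `room`: the part can spare `w` and still hold a cycle of its own.
    Fresh : List (Fin n) → Fin n → Fin n → Set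
    Fresh X v w = part w ≡ part v × U w ≡ true × w ∉ X × 6 * Δ ≤ count (λ x → part x ==F part v)

    -- The ways to reroute a cross edge u v through vertices of U outside X, the vertices in use.
    data Repair (X : List (Fin n)) (u v : Fin n) : Set where
      sound  : U u ≡ true → U v ≡ true → Repair X u v
      after  : U u ≡ true → ∀ w → Fresh X v w → adj G u w ≡ true → Repair X u v
      before : U v ≡ true → ∀ w → Fresh X u w → adj G w v ≡ true → Repair X u v
      both   : ∀ x y → Fresh X u x → Fresh X v y → adj G x y ≡ true → Repair X u v

    Repair-sym : ∀ {X u v} → Repair X u v → Repair X v u
    Repair-sym (sound p q) = sound q p
    Repair-sym (after p w f a) = before p w f (trans (adj-sym G w _) a)
    Repair-sym (before p w f a) = after p w f (trans (adj-sym G _ w) a)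
    Repair-sym (both x y f g a) = both y x g f (trans (adj-sym G y x) a)

    -- Finding a repair from the matchings

    matchedAt : (Fin n → Fin n → Bool) → Fin t → Fin t → Fin n → Bool
    matchedAt E i j u = (part u ==F i) ∧ anyF (λ v → E u v ∧ (part v ==F j))

    matchedAt⁻ : ∀ E {i j u} → matchedAt E i j u ≡ true → part u ≡ i × ∃ λ v → E u v ≡ true × part v ≡ j
    matchedAt⁻ E {i} {j} {u} h with anyF⁻ (∧-conicalʳ (part u ==F i) _ h)
    ... | v , hv = ==F⇒≡ (∧-conicalˡ _ _ h) , v , ∧-conicalˡ _ _ hv , ==F⇒≡ (∧-conicalʳ (E u v) _ hv)

    matchedAt⁺ : ∀ E {i j u v} → part u ≡ i → E u v ≡ true → part v ≡ j → matchedAt E i j u ≡ true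
    matchedAt⁺ E {v = v} p e q = ∧-true (≡⇒==F p) (anyF⁺ v (∧-true e (≡⇒==F q)))

    M'-partner : ∀ {x x' y} → M' x y ≡ true → M' x' y ≡ true → part x ≡ part x' → x ≡ x'
    M'-partner {x} {x'} {y} m m' = M-match y x x'
      (M'-sub y x (trans (M'-sym y x) m)) (M'-sub y x' (trans (M'-sym y x') m'))

    matched-≤ˡ : ∀ i j → matched part M' i j ≤ count (λ v → part v ==F i)
    matched-≤ˡ i j = count-mono (λ {u} → ∧-conicalˡ (part u ==F i) _)

    matched-≤ʳ : ∀ i j → matched part M' i j ≤ count (λ v → part v ==F j)
    matched-≤ʳ i j = subst (matched part M' i j ≤_) (sym (count-elems (λ v → part v ==F j)))
      (count-pigeonhole {R = λ x y → M' x y ≡ true × part x ≡ i}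
        (λ h → let (p , y , m , q) = matchedAt⁻ M' h in y , ∈-elems⁺ (≡⇒==F q) , m , p)
        (λ (m , p) (m' , p') → M'-partner m m' (trans p (sym p'))))

    -- Each vertex of `X` in the two parts blocks at most one edge of the matching.
    unused-edge : ∀ {i j} X → i ≢ j → length (occ i X) + length (occ j X) < matched part M' i j →
      ∃₂ λ x y → M' x y ≡ true × part x ≡ i × part y ≡ j × x ∉ X × y ∉ X
    unused-edge {i} {j} X i≢j lt with Fin.any? (λ x → Fin.any? (λ y →
      (M' x y ≟ᵇ true) ×-dec (part x ≟ i) ×-dec (part y ≟ j) ×-dec ¬? (x ∈? X) ×-dec ¬? (y ∈? X)))
    ... | yes found = found
    ... | no none = contradiction
      (subst (_ ≤_) (length-++ (occ i X)) (count-pigeonhole {R = Uses} used uses-unique)) (<⇒≱ lt)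
      where
      Uses : Fin n → Fin n → Set
      Uses x z = part x ≡ i × ((part z ≡ i × x ≡ z) ⊎ (part z ≡ j × M' x z ≡ true))
      uses-unique : ∀ {x x' z} → Uses x z → Uses x' z → x ≡ x'
      uses-unique (p , inj₁ (_ , refl)) (p' , inj₁ (_ , refl)) = refl
      uses-unique (p , inj₁ (q , _)) (p' , inj₂ (q' , _)) = contradiction (trans (sym q) q') i≢j
      uses-unique (p , inj₂ (q , _)) (p' , inj₁ (q' , _)) = contradiction (trans (sym q') q) i≢j
      uses-unique (p , inj₂ (_ , m)) (p' , inj₂ (_ , m')) = M'-partner m m' (trans p (sym p'))
      used : ∀ {x} → matchedAt M' i j x ≡ true → ∃ λ z → z ∈ occ i X ++ occ j X × Uses x z
      used {x} h with matchedAt⁻ M' h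
      ... | p , y , m , q with x ∈? X | y ∈? X
      ...   | yes x∈ | _ = x , ∈-++⁺ˡ (∈-filter⁺ (λ v → part v ≟ i) x∈ p) , p , inj₁ (p , refl)
      ...   | no _ | yes y∈ = y , ∈-++⁺ʳ (occ i X) (∈-filter⁺ (λ v → part v ≟ j) y∈ q) , p , inj₂ (q , m)
      ...   | no x∉ | no y∉ = contradiction (x , y , m , p , q , x∉ , y∉) none

    -- At most 4Δ of the 6Δ edges of M'_ij are blocked. Its 6Δ endpoints on either side also witness
    -- the part sizes that `Fresh` demands.
    repair-large : ∀ {X u v} → (∀ i → length (occ i X) ≤ 2 * Δ) → 1 ≤ Δ → part u ≢ part v →
      6 * Δ ≤ matched part M (part u) (part v) → Repair X u v
    repair-large {X} {u} {v} few pos u≢v large = repaired (unused-edge X u≢v enough)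
      where
      size : matched part M' (part u) (part v) ≡ 6 * Δ
      size = trans (M'-size (part u) (part v) u≢v) (m≤n⇒m⊓n≡m large)
      enough : length (occ (part u) X) + length (occ (part v) X) < matched part M' (part u) (part v)
      enough = begin-strict
        length (occ (part u) X) + length (occ (part v) X)  ≤⟨ +-mono-≤ (few (part u)) (few (part v)) ⟩
        2 * Δ + 2 * Δ                                      ≡⟨ *-distribʳ-+ Δ 2 2 ⟨
        4 * Δ                                              <⟨ m<m+n (4 * Δ) (≤-trans (s≤s z≤n) (*-monoʳ-≤ 2 pos)) ⟩
        4 * Δ + 2 * Δ                                      ≡⟨ *-distribʳ-+ Δ 4 2 ⟨
        6 * Δ                                              ≡⟨ size ⟨
        matched part M' (part u) (part v)                  ∎
        where open ≤-Reasoning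
      repaired : (∃₂ λ x y → M' x y ≡ true × part x ≡ part u × part y ≡ part v × x ∉ X × y ∉ X) → Repair X u v
      repaired (x , y , m , px , py , x∉ , y∉) = both x y
        (px , M'⇒U m , x∉ , ≤-trans (≤-reflexive (sym size)) (matched-≤ˡ (part u) (part v)))
        (py , M'⇒U (trans (M'-sym y x) m) , y∉ , ≤-trans (≤-reflexive (sym size)) (matched-≤ʳ (part u) (part v)))
        (proj₁ (M-edge x y (M'-sub x y m)))

    -- For a small matching nothing is discarded from M_ij, so `u` stays matched and lies in U.
    -- Either all neighbours of `u` in the part of `v` were added, `v` among them, or 6Δ - 1 > 2Δ
    -- were, and one of these is free.
    repair-small : ∀ {X u v v₁} → (∀ i → length (occ i X) ≤ 2 * Δ) → 1 ≤ Δ → adj G u v ≡ true →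
      part u ≢ part v → M u v₁ ≡ true → part v₁ ≡ part v →
      matched part M (part u) (part v) < 6 * Δ → Repair X u v
    repair-small {X} {u} {v} {v₁} few pos a u≢v m p₁ small = repaired (count nbrs ≤? 6 * Δ ∸ 1)
      where
      still-matched : ∃ λ v₂ → M' u v₂ ≡ true × part v₂ ≡ part v
      still-matched = proj₂ (matchedAt⁻ M' (count-saturated
        {f = matchedAt M' (part u) (part v)} {g = matchedAt M (part u) (part v)}
        (λ x h → let (p , y , m' , q) = matchedAt⁻ M' h in matchedAt⁺ M p (M'-sub x y m') q)
        (≤-reflexive (sym (trans (M'-size (part u) (part v) u≢v) (m≥n⇒m⊓n≡n (<⇒≤ small)))))
        u (matchedAt⁺ M refl m p₁)))
      Uu : U u ≡ true
      Uu = M'⇒U (proj₁ (proj₂ still-matched))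
      nbrs added : Fin n → Bool
      nbrs w = adj G u w ∧ (part w ==F part v)
      added w = Add u w ∧ (part w ==F part v)
      size : count added ≡ count nbrs ⊓ (6 * Δ ∸ 1)
      size = Add-size u (part v) still-matched small
      repaired : Dec (count nbrs ≤ 6 * Δ ∸ 1) → Repair X u v
      repaired (yes few-nbrs) = sound Uu (Add⇒U (∧-conicalˡ _ _ (count-saturated {f = added} {g = nbrs}
        (λ w h → ∧-true (proj₁ (Add-ok u w (∧-conicalˡ _ _ h))) (∧-conicalʳ (Add u w) _ h))
        (≤-reflexive (sym (trans size (m≤n⇒m⊓n≡m few-nbrs)))) v (∧-true a (≡⇒==F refl)))))
      repaired (no many) with count-fresh {f = added} (occ (part v) X) enough
        where
        enough : length (occ (part v) X) < count added
        enough = begin-strict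
          length (occ (part v) X)   ≤⟨ few (part v) ⟩
          2 * Δ                     <⟨ m+n≤o⇒m≤o∸n (suc (2 * Δ)) (≤-trans (≤-reflexive (+-comm (suc (2 * Δ)) 1))
                                        (≤-trans (m≤n+m (2 + 2 * Δ) 2) (4+2Δ≤6Δ pos))) ⟩
          6 * Δ ∸ 1                 ≡⟨ m≥n⇒m⊓n≡n (<⇒≤ (≰⇒> many)) ⟨
          count nbrs ⊓ (6 * Δ ∸ 1)  ≡⟨ size ⟨
          count added               ∎
          where open ≤-Reasoning
      ... | w , h , w∉ = after Uu w
          (pw , Add⇒U (∧-conicalˡ _ _ h) , (λ w∈ → w∉ (∈-filter⁺ (λ x → part x ≟ part v) w∈ pw)) ,
           -- More than 6Δ - 1 neighbours of `u` already make the part of `v` that large.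
           ≤-trans (m≤n+m∸n (6 * Δ) 1) (≤-trans (≰⇒> many) (count-mono (λ {x} → ∧-conicalʳ (adj G u x) _))))
          (proj₁ (Add-ok u w (∧-conicalˡ _ _ h)))
        where
        pw : part w ≡ part v
        pw = ==F⇒≡ (∧-conicalʳ (Add u w) _ h)

    repair-matched : ∀ {X u v v₁} → (∀ i → length (occ i X) ≤ 2 * Δ) →
      adj G u v ≡ true → part u ≢ part v → M u v₁ ≡ true → part v₁ ≡ part v → Repair X u v
    repair-matched {X} {u} {v} few a u≢v m p with 6 * Δ ≤? matched part M (part u) (part v)
    ... | yes large = repair-large few (cross⇒1≤Δ a u≢v) u≢v large
    ... | no small = repair-small few (cross⇒1≤Δ a u≢v) a u≢v m p (≰⇒> small)

    -- By maximality one end of the edge is matched into the part of the other; reversing the edge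
    -- exchanges the two cases.
    repair : ∀ {X u v} → (∀ i → length (occ i X) ≤ 2 * Δ) →
      adj G u v ≡ true → part u ≢ part v → Repair X u v
    repair {X} {u} {v} few a u≢v with M-max u v a u≢v
    ... | inj₁ (v₁ , m , p) = repair-matched few a u≢v m p
    ... | inj₂ (u₁ , m , p) = Repair-sym (repair-matched few (trans (adj-sym G v u) a) (≢-sym u≢v) m p)

    -- Rerouting the edges one by one

    -- The inserted vertices lie in different parts, so a part that receives one has at most 2Δ + 1
    -- vertices in use out of at least 6Δ ≥ 2Δ + 4. The other parts are unaffected.
    room-after : ∀ {X ps k} → 1 ≤ Δ → (∀ i → length (occ i X) ≤ 2 * Δ) →
      AllPairs (λ v w → part v ≢ part w) ps → All (λ w → 6 * Δ ≤ count (λ x → part x ==F part w)) ps →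
      3 ≤ length (avail allV k X) → 3 ≤ length (avail allV k (ps ++ X))
    room-after {X} {ps} {k} pos few dist large room-before with any? (λ w → part w ≟ k) ps
    ... | no none = ≤-trans room-before (avail-mono (λ p v∈ →
      [ (λ v∈ps → contradiction (lose v∈ps p) none) , id ]′ (∈-++⁻ ps v∈)))
    ... | yes some with find some
    ...   | w , w∈ , refl = +-cancelʳ-≤ (1 + 2 * Δ) 3 _ (begin
      3 + (1 + 2 * Δ)                                              ≡⟨⟩
      4 + 2 * Δ                                                    ≤⟨ 4+2Δ≤6Δ pos ⟩
      6 * Δ                                                        ≤⟨ All.lookup large w∈ ⟩
      count (λ x → part x ==F part w)                              ≤⟨ count-≤-avail+occ (ps ++ X) (λ h → refl , ==F⇒≡ h) ⟩
      free + length (occ (part w) (ps ++ X))                       ≡⟨ cong (free +_) (length-occ-++ (part w) ps X) ⟩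
      free + (length (occ (part w) ps) + length (occ (part w) X))  ≤⟨ +-monoʳ-≤ free (+-mono-≤ (occ-distinct-≤1 (part w) dist) (few (part w))) ⟩
      free + (1 + 2 * Δ)                                           ∎)
      where
      open ≤-Reasoning
      free = length (avail allV (part w) (ps ++ X))

    replace-edge : ∀ {is cs u v} ps new → State allV is cs → Tight cs → (u , v) ∈ edges cs → part u ≢ part v →
      bad (u , v) ≡ true →
      (∀ r → cycEdges (u ∷ ps ++ v ∷ r) ≡ new ++ zip (v ∷ r) (r ++ u ∷ [])) →
      All Adjacent new → (∀ i j → i ≢ j → countL (between i j) new ≡ countL (between i j) ((u , v) ∷ [])) →
      All (λ e → bad e ≡ false) new → AllPairs (λ v w → part v ≢ part w) ps →
      All (λ w → w ∉ concat cs × 6 * Δ ≤ count (λ x → part x ==F part w)) ps →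
      ∃ λ ds → State allV is ds × length ds ≡ length cs × suc (countL bad (edges ds)) ≡ countL bad (edges cs)
    replace-edge {cs = cs} ps new st tight e∈ u≢v bad-uv new-edges adjs same good dist fresh
      with splice ps new st e∈ new-edges adjs same (AllPairs.map (λ ne eq → ne (cong part eq)) dist)
        (All.map (λ (w∉ , _) → w∉ , refl) fresh) (λ eq → contradiction eq u≢v)
        (λ i∈ → room-after (cross⇒1≤Δ (All.lookup (adjacent (skeleton st)) e∈) u≢v)
          (occ-≤-2Δ (skeleton st) tight) dist (All.map proj₂ fresh) (room st i∈))
    ... | ds , st′ , len , _ , es , τ , τ′ = ds , st′ , len ,
      trans (cong suc (trans (countL-↭ bad τ) (trans (countL-++ bad new) (cong (_+ countL bad es) (countL-zero bad good)))))
        (sym (trans (countL-↭ bad τ′) (cong (λ b → (if b then 1 else 0) + countL bad es) bad-uv)))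

    one : Bool → ℕ
    one b = if b then 1 else 0

    large-at : ∀ {i w} → part w ≡ i → 6 * Δ ≤ count (λ x → part x ==F i) → 6 * Δ ≤ count (λ x → part x ==F part w)
    large-at refl le = le

    between-parts : ∀ {i j u v x y} → part x ≡ part u → part y ≡ part v → between i j (x , y) ≡ between i j (u , v)
    between-parts {i} {j} = cong₂ (λ p q → ((p ==F i) ∧ (q ==F j)) ∨ ((p ==F j) ∧ (q ==F i)))

    -- In each case the new path has exactly one cross edge, between the parts of `u` and `v` and
    -- with both ends in U; its other edges come from the cliques.
    repair-step : ∀ {is cs u v} → State allV is cs → Tight cs → (u , v) ∈ edges cs → part u ≢ part v →
      bad (u , v) ≡ true →
      ∃ λ ds → State allV is ds × length ds ≡ length cs × suc (countL bad (edges ds)) ≡ countL bad (edges cs)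
    repair-step {cs = cs} {u} {v} st tight e∈ u≢v bad-uv
      with edge-ends cs e∈ | repair (occ-≤-2Δ (skeleton st) tight) (All.lookup (adjacent (skeleton st)) e∈) u≢v
    ... | _ , _ | sound p q = contradiction (bad-U {u} {v} p q) (true≢false bad-uv)
    ... | _ , v∈ | after Uu w (pw , Uw , w∉ , large) a =
      replace-edge (w ∷ []) ((u , w) ∷ (w , v) ∷ []) st tight e∈ u≢v bad-uv (λ r → refl)
        (a ∷ clique w v pw (λ { refl → w∉ v∈ }) ∷ [])
        (λ i j i≢j → cong₂ (λ b c → one b + (one c + 0))
          (between-parts {x = u} refl pw) (between-intra i≢j (w , v) pw))
        (bad-U {u} {w} Uu Uw ∷ bad-intra (w , v) pw ∷ [])
        ([] ∷ []) ((w∉ , large-at pw large) ∷ [])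
    ... | u∈ , _ | before Uv w (pw , Uw , w∉ , large) a =
      replace-edge (w ∷ []) ((u , w) ∷ (w , v) ∷ []) st tight e∈ u≢v bad-uv (λ r → refl)
        (clique u w (sym pw) (λ { refl → w∉ u∈ }) ∷ a ∷ [])
        (λ i j i≢j → cong₂ (λ b c → one b + (one c + 0))
          (between-intra i≢j (u , w) (sym pw)) (between-parts {y = v} pw refl))
        (bad-intra (u , w) (sym pw) ∷ bad-U {w} {v} Uw Uv ∷ [])
        ([] ∷ []) ((w∉ , large-at pw large) ∷ [])
    ... | u∈ , v∈ | both x y (px , Ux , x∉ , large) (py , Uy , y∉ , large') a =
      replace-edge (x ∷ y ∷ []) ((u , x) ∷ (x , y) ∷ (y , v) ∷ []) st tight e∈ u≢v bad-uv (λ r → refl)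
        (clique u x (sym px) (λ { refl → x∉ u∈ }) ∷ a ∷ clique y v py (λ { refl → y∉ v∈ }) ∷ [])
        (λ i j i≢j → trans
          (cong₂ (λ b c → one b + (one (between i j (x , y)) + (one c + 0)))
            (between-intra i≢j (u , x) (sym px)) (between-intra i≢j (y , v) py))
          (cong (λ b → one b + 0) (between-parts px py)))
        (bad-intra (u , x) (sym px) ∷ bad-U {x} {y} Ux Uy ∷ bad-intra (y , v) py ∷ [])
        (((λ eq → u≢v (trans (sym px) (trans eq py))) ∷ []) ∷ [] ∷ [])
        ((x∉ , large-at px large) ∷ (y∉ , large-at py large') ∷ [])

    repair-all : ∀ m {is cs} → State allV is cs → countL bad (edges cs) ≡ m →
      ∃ λ ds → State U is ds × length ds ≡ length cs
    -- Tightening restores the bound 2Δ and keeps the number of bad edges, because `bad` vanishes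
    -- inside parts.
    repair-all m st eq with tighten st
    ... | ds , (st′ , len , same) , tight with trans (same bad bad-intra) eq
    repair-all zero st eq | ds , (st′ , len , same) , tight | none = ds , restrict st′ tight none , len
    repair-all (suc m) st eq | ds , (st′ , len , same) , tight | some
      with countL-pos⁻ bad (edges ds) (≤-trans (s≤s z≤n) (≤-reflexive (sym some)))
    ... | (u , v) , e∈ , b with repair-step st′ tight e∈ (true≢false b ∘ bad-intra (u , v)) b
    ...   | es , st″ , len′ , fewer with repair-all m st″ (suc-injective (trans fewer some))
    ...     | fs , st‴ , len″ = fs , st‴ , trans len″ (trans len′ len)

    -- The two directions

    cover-⇒ : ∀ {k} → HasCanonicalCover G part allV k → HasCanonicalCover G part U k
    cover-⇒ cover with cover⇒State cover
    ... | is , cs , uniq , st , refl with repair-all _ st refl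
    ...   | ds , st′ , len = subst (λ l → HasCanonicalCover G part U (l + length is)) len (State⇒cover uniq st′)

    cover-⇐ : ∀ {k} → HasCanonicalCover G part U k → HasCanonicalCover G part allV k
    cover-⇐ cover with cover⇒State cover
    ... | is , cs , uniq , st , refl with tighten st
    ...   | ds , (st′ , len , _) , tight =
      subst (λ l → HasCanonicalCover G part allV (l + length is)) len (State⇒cover uniq (extend st′ tight))

theorem5p7 : ∀ {n t} (G : Graph n) (part : Fin n → Fin t) →
    IsCliquePartition G part → (Δ : ℕ) → MaxDegreeQuot G part Δ →
    (C : Construction G part Δ) → (k : ℕ) →
    HasCanonicalCover G part allV k ⇔ HasCanonicalCover G part (Construction.U C) k
theorem5p7 G part (_ , clique) Δ (maxdeg , _) C k = mk⇔ cover-⇒ cover-⇐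
  where open Skeletons.Reduction G part clique Δ maxdeg C
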